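{- Let $P(t)=\sum_{n\ge0}p_nt^n$, where $p_n$ is the number of permutations of length $n$ sortable by two stacks in parallel, and let $t_c$ be the radius of convergence of $P$. Then for every $t\in[0,t_c)$, \[\sqrt{2P(t)}\ \ge\ 1+\sqrt{2tP(t)},\] and the inequality also holds at $t=t_c$, where $P(t_c)=\lim_{t\to t_c^- }P(t)$.
   Context: A permutation $\sigma$ of $\{1,\dots,n\}$ is \emph{sortable by two stacks in parallel} if, starting with the sequence $\sigma(1)\sigma(2)\cdots\sigma(n)$ as input and two initially empty stacks, one can repeatedly either move the next input element onto the top of either stack, or move the top element of either stack to the output, so that at the end the output is $1,2,\dots,n$ in that order. A permutation is \emph{sortable by a deque} if the same holds with the two stacks replaced by a single double-ended queue (elements may be inserted and removed at either end). Let $D(t)=\sum_{n\ge0}d_nt^n$, $d_n$ the number of deque-sortable permutations of length $n$. It is known (and may be assumed) that, writing $P=P(t)$, \[2D(t)=2+t+2Pt-2Pt^2-t\sqrt{1-4P+4P^2-8P^2t+4P^2t^2-4Pt}\] as formal power series, and that $P$ and $D$ have the same radius of convergence $t_c$ (equal exponential growth rates of $p_n$ and $d_n$), with $t_c<1$. -}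

module Defs where

open import Data.Nat as ℕ using (ℕ; zero; suc)
import Data.Nat.Properties as ℕ
open import Data.Integer as ℤ using (ℤ; +_; -[1+_])
import Data.Integer.Properties as ℤ
open import Data.Rational as ℚ using (ℚ; mkℚ; 0ℚ; 1ℚ; ½)
import Data.Rational.Properties as ℚ
import Data.Rational.Unnormalised as ℚᵘ
import Data.Rational.Unnormalised.Properties as ℚᵘ
open import Data.Nat.Coprimality using (Coprime)
open import Data.Rational.Solver using (module +-*-Solver)
open import Data.Product using (∃; _×_; _,_; proj₁; proj₂; map₂)
open import Data.Sum using (_⊎_; inj₁; inj₂; [_,_]′)
open import Data.Empty using (⊥; ⊥-elim)
open import Relation.Binary.PropositionalEquality using (_≡_; refl; sym; trans; cong; cong₂; subst; subst₂)
open import Relation.Nullary using (¬_; Dec; yes; no)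
open import Data.Fin using (Fin)
import Data.Fin.Properties as Fin
open import Data.List using (List; []; _∷_; _++_; _∷ʳ_; [_]; map; concatMap; filter; length; reverse; allFin)
open import Data.List.Properties using (length-++; length-tabulate; ≡-dec)
open import Data.List.Membership.Propositional using (_∈_; find; lose)
open import Data.List.Relation.Unary.Any using (Any; any?)
open import Data.List.Relation.Unary.Unique.DecPropositional using (unique?)
open import Relation.Binary.Construct.Closure.ReflexiveTransitive using (Star; _◅_) renaming (ε to stop)
open import Relation.Nullary.Decidable using (_×-dec_; _⊎-dec_; map′)

-- push and pop are nondeterministic: they list all the possible outcomes.
record Device (A : Set) : Set₁ where
  field
    Store : Set
    empty : Store
    push  : A → Store → List Store
    pop   : Store → List (A × Store)

-- The accessible element of a stack together with what remains under it;
-- a stack is a list whose head is its top.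
top : {A : Set} → List A → List (A × List A)
top []       = []
top (x ∷ xs) = [ (x , xs) ]

twoStacks : (A : Set) → Device A
twoStacks A = record
  { Store = List A × List A
  ; empty = [] , []
  ; push  = λ x (s₁ , s₂) → (x ∷ s₁ , s₂) ∷ (s₁ , x ∷ s₂) ∷ []
  ; pop   = λ (s₁ , s₂) → map (map₂ (λ s₁′ → s₁′ , s₂)) (top s₁)
                       ++ map (map₂ (λ s₂′ → s₁ , s₂′)) (top s₂)
  }

deque : (A : Set) → Device A
deque A = record
  { Store = List A
  ; empty = []
  ; push  = λ x s → (x ∷ s) ∷ (s ∷ʳ x) ∷ []
  ; pop   = λ s → top s ++ map (map₂ reverse) (top (reverse s))
  }

module Sorting {n : ℕ} (M : Device (Fin n)) where
  open Device M

  record State : Set where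
    constructor ⟨_,_,_⟩
    field
      input  : List (Fin n)
      store  : Store
      output : List (Fin n)
  open State

  data _⟶_ : State → State → Set where
    read  : ∀ {x i s s′ o} → s′ ∈ push x s → ⟨ x ∷ i , s , o ⟩ ⟶ ⟨ i , s′ , o ⟩
    write : ∀ {x i s s′ o} → (x , s′) ∈ pop s → ⟨ i , s , o ⟩ ⟶ ⟨ i , s′ , o ∷ʳ x ⟩

  _⟶*_ : State → State → Set
  _⟶*_ = Star _⟶_

  -- The final store is automatically empty when the input is a permutation,
  -- because every letter has then been output.
  Finishes : State → Set
  Finishes q = ∃ λ s → q ⟶* ⟨ [] , s , allFin n ⟩

  Sortable : List (Fin n) → Set
  Sortable σ = Finishes ⟨ σ , empty , [] ⟩

  private
    length-∷ʳ : (o : List (Fin n)) (x : Fin n) → length (o ∷ʳ x) ≡ suc (length o)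
    length-∷ʳ o x = trans (length-++ o) (ℕ.+-comm (length o) 1)

    output-grows : ∀ {q r} → q ⟶* r → length (output q) ℕ.≤ length (output r)
    output-grows stop             = ℕ.≤-refl
    output-grows (read _ ◅ steps) = output-grows steps
    output-grows (write {x = x} {o = o} _ ◅ steps) =
      ℕ.≤-trans (ℕ.≤-trans (ℕ.n≤1+n _) (ℕ.≤-reflexive (sym (length-∷ʳ o x))))
                (output-grows steps)

    output-bound : ∀ {q} → Finishes q → length (output q) ℕ.≤ n
    output-bound (_ , steps) =
      ℕ.≤-trans (output-grows steps) (ℕ.≤-reflexive (length-tabulate (λ i → i)))

  private
    Done ByRead ByWrite : List (Fin n) → Store → List (Fin n) → Set
    Done i s o          = i ≡ [] × o ≡ allFin n
    ByRead [] s o       = ⊥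
    ByRead (x ∷ i) s o  = Any (λ s′ → Finishes ⟨ i , s′ , o ⟩) (push x s)
    ByWrite i s o       = Any (λ (x , s′) → Finishes ⟨ i , s′ , o ∷ʳ x ⟩) (pop s)

    fold : ∀ {i s o} → Done i s o ⊎ (ByRead i s o ⊎ ByWrite i s o) → Finishes ⟨ i , s , o ⟩
    fold (inj₁ (refl , refl)) = _ , stop
    fold {i = x ∷ i} (inj₂ (inj₁ p)) =
      let (_ , s′∈ , (s″ , steps)) = find p in s″ , read s′∈ ◅ steps
    fold (inj₂ (inj₂ p)) =
      let (_ , xs′∈ , (s″ , steps)) = find p in s″ , write xs′∈ ◅ steps

    unfold : ∀ {i s o} → Finishes ⟨ i , s , o ⟩ → Done i s o ⊎ (ByRead i s o ⊎ ByWrite i s o)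
    unfold (_ , stop)              = inj₁ (refl , refl)
    unfold (_ , read s′∈ ◅ steps)  = inj₂ (inj₁ (lose s′∈ (_ , steps)))
    unfold (_ , write xs′∈ ◅ steps) = inj₂ (inj₂ (lose xs′∈ (_ , steps)))

    -- g is the number of elements still to be written, so that (i , g) decreases
    -- lexicographically.
    finishes? : ∀ i s o g → length o ℕ.+ g ≡ n → Dec (Finishes ⟨ i , s , o ⟩)
    byRead?   : ∀ i s o g → length o ℕ.+ g ≡ n → Dec (ByRead i s o)
    byWrite?  : ∀ i s o g → length o ℕ.+ g ≡ n → Dec (ByWrite i s o)

    finishes? i s o g eq =
      map′ fold unfold
        ((≡-dec Fin._≟_ i [] ×-dec ≡-dec Fin._≟_ o (allFin n))
          ⊎-dec (byRead? i s o g eq ⊎-dec byWrite? i s o g eq))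

    byRead? []      s o g eq = no λ ()
    byRead? (x ∷ i) s o g eq = any? (λ s′ → finishes? i s′ o g eq) (push x s)

    byWrite? i s o zero eq = no λ p →
      let ((x , _) , _ , f) = find p
      in ℕ.<-irrefl (trans (sym (ℕ.+-identityʳ _)) eq)
           (ℕ.≤-trans (ℕ.≤-reflexive (sym (length-∷ʳ o x))) (output-bound f))
    byWrite? i s o (suc g) eq =
      any? (λ (x , s′) → finishes? i s′ (o ∷ʳ x) g
              (trans (cong (ℕ._+ g) (length-∷ʳ o x)) (trans (sym (ℕ.+-suc _ g)) eq)))
           (pop s)

  sortable? : ∀ σ → Dec (Sortable σ)
  sortable? σ = finishes? σ empty [] n refl

words : (n k : ℕ) → List (List (Fin n))
words n zero    = [ [] ]
words n (suc k) = concatMap (λ x → map (x ∷_) (words n k)) (allFin n)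

-- Permutations of {0,…,n-1} in one-line notation: the words of length n over
-- Fin n without repeated letters.
permutations : (n : ℕ) → List (List (Fin n))
permutations n = filter (unique? Fin._≟_) (words n n)

numParallel : ℕ → ℕ
numParallel n = length (filter (Sorting.sortable? (twoStacks (Fin n))) (permutations n))

numDeque : ℕ → ℕ
numDeque n = length (filter (Sorting.sortable? (deque (Fin n))) (permutations n))

ι : ℕ → ℚ
ι n = + n ℚ./ 1

module Rational where
  open import Data.Rational using (_+_; _*_; _-_; -_; _<_; _≤_; _⊔_; ∣_∣)
  open +-*-Solver using (solve; _:=_; _:+_; _:*_; _:-_; :-_; con)

  ι-ᵘ : ∀ n → ℚ.toℚᵘ (ι n) ℚᵘ.≃ ℚᵘ.mkℚᵘ (+ n) 0
  ι-ᵘ n = ℚ.toℚᵘ-fromℚᵘ (ℚᵘ.mkℚᵘ (+ n) 0)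

  ι-+ : ∀ m n → ι (m ℕ.+ n) ≡ ι m + ι n
  ι-+ m n = ℚ.toℚᵘ-injective (ℚᵘ.≃-trans (ι-ᵘ (m ℕ.+ n)) (ℚᵘ.≃-trans
    (ℚᵘ.*≡* (trans (ℤ.*-identityʳ _) (sym (trans (ℤ.*-identityʳ _)
       (cong₂ ℤ._+_ (ℤ.*-identityʳ (+ m)) (ℤ.*-identityʳ (+ n)))))))
    (ℚᵘ.≃-trans (ℚᵘ.+-cong (ℚᵘ.≃-sym (ι-ᵘ m)) (ℚᵘ.≃-sym (ι-ᵘ n)))
      (ℚᵘ.≃-sym (ℚ.toℚᵘ-homo-+ (ι m) (ι n))))))

  ι-* : ∀ m n → ι (m ℕ.* n) ≡ ι m * ι n
  ι-* m n = ℚ.toℚᵘ-injective (ℚᵘ.≃-trans (ι-ᵘ (m ℕ.* n)) (ℚᵘ.≃-trans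
    (ℚᵘ.*≡* (cong (ℤ._* + 1) (ℤ.pos-* m n)))
    (ℚᵘ.≃-trans (ℚᵘ.*-cong (ℚᵘ.≃-sym (ι-ᵘ m)) (ℚᵘ.≃-sym (ι-ᵘ n)))
      (ℚᵘ.≃-sym (ℚ.toℚᵘ-homo-* (ι m) (ι n))))))

  ι-≤ : ∀ m n → m ℕ.≤ n → ι m ≤ ι n
  ι-≤ m n m≤n = ℚ.toℚᵘ-cancel-≤
    (ℚᵘ.≤-respˡ-≃ (ℚᵘ.≃-sym (ι-ᵘ m)) (ℚᵘ.≤-respʳ-≃ (ℚᵘ.≃-sym (ι-ᵘ n))
      (ℚᵘ.*≤* (ℤ.*-monoʳ-≤-nonNeg (+ 1) (ℤ.+≤+ m≤n)))))

  ι-< : ∀ m n → m ℕ.< n → ι m < ι n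
  ι-< m n m<n = ℚ.toℚᵘ-cancel-<
    (ℚᵘ.<-respˡ-≃ (ℚᵘ.≃-sym (ι-ᵘ m)) (ℚᵘ.<-respʳ-≃ (ℚᵘ.≃-sym (ι-ᵘ n))
      (ℚᵘ.*<* (ℤ.*-monoʳ-<-pos (+ 1) (ℤ.+<+ m<n)))))

  clear : ∀ k d .(c : Coprime k (suc d)) → mkℚ (+ k) d c * ι (suc d) ≡ ι k
  clear k d c = ℚ.toℚᵘ-injective (ℚᵘ.≃-trans (ℚ.toℚᵘ-homo-* (mkℚ (+ k) d c) (ι (suc d)))
    (ℚᵘ.≃-trans (ℚᵘ.*-congˡ {ℚᵘ.mkℚᵘ (+ k) d} (ι-ᵘ (suc d)))
     (ℚᵘ.≃-trans (ℚᵘ.*≡* (trans (ℤ.*-identityʳ _) (cong (+ k ℤ.*_) (cong +_ (sym (ℕ.*-identityʳ (suc d)))))))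
      (ℚᵘ.≃-sym (ι-ᵘ k)))))

  *-mono : ∀ {a b c d} → 0ℚ ≤ a → 0ℚ ≤ d → a ≤ b → c ≤ d → a * c ≤ b * d
  *-mono {a} {b} {c} {d} 0≤a 0≤d a≤b c≤d =
    ℚ.≤-trans (ℚ.*-monoˡ-≤-nonNeg a {{ℚ.nonNegative 0≤a}} c≤d)
              (ℚ.*-monoʳ-≤-nonNeg d {{ℚ.nonNegative 0≤d}} a≤b)

  *-pos : ∀ {a b} → 0ℚ < a → 0ℚ < b → 0ℚ < a * b
  *-pos {a} {b} 0<a 0<b =
    ℚ.positive⁻¹ (a * b) {{ℚ.pos*pos⇒pos a {{ℚ.positive 0<a}} b {{ℚ.positive 0<b}}}}

  *-nonneg : ∀ {a b} → 0ℚ ≤ a → 0ℚ ≤ b → 0ℚ ≤ a * b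
  *-nonneg {a} {b} 0≤a 0≤b = subst (_≤ a * b) (ℚ.*-zeroˡ 0ℚ) (*-mono ℚ.≤-refl 0≤b 0≤a 0≤b)

  +-nonneg : ∀ {a b} → 0ℚ ≤ a → 0ℚ ≤ b → 0ℚ ≤ a + b
  +-nonneg {a} {b} p q = subst (_≤ a + b) (ℚ.+-identityˡ 0ℚ) (ℚ.+-mono-≤ p q)

  +-pos : ∀ {a b} → 0ℚ < a → 0ℚ < b → 0ℚ < a + b
  +-pos {a} {b} p q = subst (_< a + b) (ℚ.+-identityˡ 0ℚ) (ℚ.+-mono-< p q)

  -- a² < b² and 0 ≤ b give a < b
  sq-cancel : ∀ {a b} → 0ℚ ≤ b → a * a < b * b → a < b
  sq-cancel {a} {b} 0≤b lt with a ℚ.<? b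
  ... | yes a<b = a<b
  ... | no ¬a<b = let b≤a = ℚ.≮⇒≥ ¬a<b in
    ⊥-elim (ℚ.<-irrefl refl (ℚ.<-≤-trans lt (*-mono 0≤b (ℚ.≤-trans 0≤b b≤a) b≤a b≤a)))

  halve : ∀ e → ½ * e + ½ * e ≡ e
  halve e = trans (sym (ℚ.*-distribʳ-+ e ½ ½)) (ℚ.*-identityˡ e)

  half-pos : ∀ {e} → 0ℚ < e → 0ℚ < ½ * e
  half-pos = *-pos (ℚ.positive⁻¹ ½)

  abs< : ∀ {a e} → a < e → - a < e → ∣ a ∣ < e
  abs< {a} {e} p q = [ (λ eq → subst (_< e) (sym eq) p) , (λ eq → subst (_< e) (sym eq) q) ]′
                       (ℚ.∣p∣≡p∨∣p∣≡-p a)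

  abs≤ : ∀ {a e} → a ≤ e → - a ≤ e → ∣ a ∣ ≤ e
  abs≤ {a} {e} p q = [ (λ eq → subst (_≤ e) (sym eq) p) , (λ eq → subst (_≤ e) (sym eq) q) ]′
                       (ℚ.∣p∣≡p∨∣p∣≡-p a)

  ≤abs : ∀ a → a ≤ ∣ a ∣
  ≤abs a with ℚ.≤-total 0ℚ a
  ... | inj₁ 0≤a = ℚ.≤-reflexive (sym (ℚ.0≤p⇒∣p∣≡p 0≤a))
  ... | inj₂ a≤0 = ℚ.≤-trans a≤0 (ℚ.0≤∣p∣ a)

  abs-sym : ∀ a b → ∣ a - b ∣ ≡ ∣ b - a ∣
  abs-sym a b = trans (sym (ℚ.∣-p∣≡∣p∣ (a - b)))
    (cong ∣_∣ (solve 2 (λ a b → :- (a :- b) := b :- a) refl a b))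

  -- |a - b| < e  gives  a < b + e
  near : ∀ {a b e} → ∣ a - b ∣ < e → a < b + e
  near {a} {b} {e} lt = subst (_< b + e) (solve 2 (λ a b → b :+ (a :- b) := a) refl a b)
    (ℚ.+-monoʳ-< b (ℚ.≤-<-trans (≤abs (a - b)) lt))

  near⁻¹ : ∀ {a b e} → a < b + e → b < a + e → ∣ a - b ∣ < e
  near⁻¹ {a} {b} {e} p q = abs<
    (subst (a - b <_) (solve 2 (λ b e → (b :+ e) :- b := e) refl b e) (ℚ.+-monoˡ-< (- b) p))
    (subst₂ _<_ (solve 2 (λ a b → b :- a := :- (a :- b)) refl a b)
                (solve 2 (λ a e → (a :+ e) :- a := e) refl a e) (ℚ.+-monoˡ-< (- a) q))

  abs-nonexpanding : ∀ a b → ∣ ∣ a ∣ - ∣ b ∣ ∣ ≤ ∣ a - b ∣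
  abs-nonexpanding a b = abs≤ (half a b)
    (subst₂ _≤_ (solve 2 (λ x y → y :- x := :- (x :- y)) refl ∣ a ∣ ∣ b ∣) (abs-sym b a) (half b a))
    where
    half : ∀ a b → ∣ a ∣ - ∣ b ∣ ≤ ∣ a - b ∣
    half a b = subst₂ _≤_
      (cong (λ z → ∣ z ∣ - ∣ b ∣) (solve 2 (λ a b → (a :- b) :+ b := a) refl a b))
      (solve 2 (λ x y → (x :+ y) :- y := x) refl ∣ a - b ∣ ∣ b ∣)
      (ℚ.+-monoˡ-≤ (- ∣ b ∣) (ℚ.∣p+q∣≤∣p∣+∣q∣ (a - b) b))

  pos-nonexpanding : ∀ {a b e} → 0ℚ < e → a < b + e → 0ℚ ⊔ a < (0ℚ ⊔ b) + e
  pos-nonexpanding {a} {b} {e} 0<e lt with ℚ.≤-total 0ℚ a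
  ... | inj₁ 0≤a = subst (_< (0ℚ ⊔ b) + e) (sym (ℚ.p≤q⇒p⊔q≡q 0≤a))
                     (ℚ.<-≤-trans lt (ℚ.+-monoˡ-≤ e (ℚ.p≤q⊔p 0ℚ b)))
  ... | inj₂ a≤0 = subst (_< (0ℚ ⊔ b) + e) (sym (ℚ.p≥q⇒p⊔q≡p a≤0))
                     (subst (_< (0ℚ ⊔ b) + e) (ℚ.+-identityˡ 0ℚ)
                       (ℚ.+-mono-≤-< (ℚ.p≤p⊔q 0ℚ b) 0<e))

  divide : ∀ {b e} → 0ℚ < b → 0ℚ < e → ∃ λ δ → 0ℚ < δ × b * δ ≡ e
  divide {b} {e} 0<b 0<e =
    let instance
          b⁺ = ℚ.positive 0<b
          b≠0 = ℚ.pos⇒nonZero b {{b⁺}}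
          1/b⁺ = ℚ.1/pos⇒pos b {{b⁺}}
    in ℚ.1/ b * e , *-pos (ℚ.positive⁻¹ (ℚ.1/ b)) 0<e ,
       trans (sym (ℚ.*-assoc b (ℚ.1/ b) e)) (trans (cong (_* e) (ℚ.*-inverseʳ b)) (ℚ.*-identityˡ e))

  unit : ℕ → ℚ
  unit n = + 1 ℚ./ suc n

  clear-/ : ∀ k m → (+ k ℚ./ suc m) * ι (suc m) ≡ ι k
  clear-/ k m = ℚ.toℚᵘ-injective (ℚᵘ.≃-trans (ℚ.toℚᵘ-homo-* (+ k ℚ./ suc m) (ι (suc m)))
    (ℚᵘ.≃-trans (ℚᵘ.*-cong (ℚ.toℚᵘ-fromℚᵘ (ℚᵘ.mkℚᵘ (+ k) m)) (ι-ᵘ (suc m)))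
     (ℚᵘ.≃-trans (ℚᵘ.*≡* (trans (ℤ.*-identityʳ _) (cong (+ k ℤ.*_) (cong +_ (sym (ℕ.*-identityʳ (suc m)))))))
      (ℚᵘ.≃-sym (ι-ᵘ k)))))

  ι-pos : ∀ m → 0ℚ < ι (suc m)
  ι-pos m = ι-< 0 (suc m) (ℕ.s≤s ℕ.z≤n)

  unit-pos : ∀ n → 0ℚ < unit n
  unit-pos n = ℚ.*-cancelʳ-<-nonNeg (ι (suc n)) {{ℚ.nonNegative (ℚ.<⇒≤ (ι-pos n))}}
    (subst₂ _<_ (sym (ℚ.*-zeroˡ (ι (suc n)))) (sym (clear-/ 1 n)) (ι-pos 0))

  unit≤1 : ∀ n → unit n ≤ 1ℚ
  unit≤1 n = ℚ.*-cancelʳ-≤-pos (ι (suc n)) {{ℚ.positive (ι-pos n)}}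
    (subst₂ _≤_ (sym (clear-/ 1 n)) (sym (ℚ.*-identityˡ (ι (suc n)))) (ι-≤ 1 (suc n) (ℕ.s≤s ℕ.z≤n)))

  archimedean : ∀ {e} → 0ℚ < e → ∃ λ N → ∀ n → N ℕ.≤ n → unit n ≤ e
  archimedean {mkℚ (+ zero) d c} 0<e = ⊥-elim (ℤ.<-irrefl refl (ℚ.drop-*<* 0<e))
  archimedean {mkℚ -[1+ k ] d c} 0<e = ⊥-elim (ℤ.<⇒≱ (ℚ.drop-*<* 0<e) ℤ.-≤+)
  archimedean e@{mkℚ (+ suc k) d c} 0<e = d , λ n d≤n →
    ℚ.*-cancelʳ-≤-pos (ι (suc n)) {{ℚ.positive (ι-pos n)}}
      (ℚ.≤-trans (ℚ.≤-reflexive (clear-/ 1 n))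
        (ℚ.≤-trans (ι-≤ 1 (suc k) (ℕ.s≤s ℕ.z≤n))
          (ℚ.≤-trans (ℚ.≤-reflexive (sym (clear (suc k) d c)))
            (*-mono {a = mkℚ (+ suc k) d c} (ℚ.<⇒≤ 0<e) (ℚ.<⇒≤ (ι-pos n)) ℚ.≤-refl (ι-≤ (suc d) (suc n) (ℕ.s≤s d≤n))))))

  isqrt : ℕ → ℕ
  isqrt zero = zero
  isqrt (suc n) with suc (isqrt n) ℕ.* suc (isqrt n) ℕ.≤? suc n
  ... | yes _ = suc (isqrt n)
  ... | no  _ = isqrt n

  isqrt-lower : ∀ n → isqrt n ℕ.* isqrt n ℕ.≤ n
  isqrt-lower zero = ℕ.z≤n
  isqrt-lower (suc n) with suc (isqrt n) ℕ.* suc (isqrt n) ℕ.≤? suc n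
  ... | yes le = le
  ... | no  _  = ℕ.m≤n⇒m≤1+n (isqrt-lower n)

  isqrt-upper : ∀ n → n ℕ.< suc (isqrt n) ℕ.* suc (isqrt n)
  isqrt-upper zero = ℕ.s≤s ℕ.z≤n
  isqrt-upper (suc n) with suc (isqrt n) ℕ.* suc (isqrt n) ℕ.≤? suc n
  ... | no ≰  = ℕ.≰⇒> ≰
  ... | yes _ = ℕ.≤-<-trans (isqrt-upper n)
    (ℕ.*-mono-< (ℕ.n<1+n (suc (isqrt n))) (ℕ.n<1+n (suc (isqrt n))))

  -- For q ≥ 0, the largest multiple of 1/(b(n+1)) whose square is at most q = a/b.
  sqrtℚ : ℕ → ℚ → ℚ
  sqrtℚ n q = + isqrt (ℤ.∣ ℚ.↥ q ∣ ℕ.* ℚ.↧ₙ q ℕ.* (suc n ℕ.* suc n)) ℚ./ (ℚ.↧ₙ q ℕ.* suc n)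

  private
    module Approx (n a b : ℕ) .(c : Coprime a (suc b)) where
      q = mkℚ (+ a) b c
      N = a ℕ.* suc b ℕ.* (suc n ℕ.* suc n)
      k = isqrt N
      r = sqrtℚ n q
      M = ι (suc b ℕ.* suc n)

      M⁺ : 0ℚ < M * M
      M⁺ = *-pos (ι-pos (n ℕ.+ b ℕ.* suc n)) (ι-pos (n ℕ.+ b ℕ.* suc n))

      rM : r * M ≡ ι k
      rM = clear-/ k (n ℕ.+ b ℕ.* suc n)

      qMM : q * (M * M) ≡ ι N
      qMM = trans (cong (λ z → q * (z * z)) (ι-* (suc b) (suc n)))
        (trans (solve 3 (λ q d m → q :* ((d :* m) :* (d :* m)) := (q :* d) :* d :* (m :* m))
                  refl q (ι (suc b)) (ι (suc n)))
        (trans (cong₂ (λ x y → x * ι (suc b) * y) (clear a b c) (sym (ι-* (suc n) (suc n))))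
        (trans (cong (_* ι (suc n ℕ.* suc n)) (sym (ι-* a (suc b))))
          (sym (ι-* (a ℕ.* suc b) (suc n ℕ.* suc n))))))

      lower : r * r ≤ q
      lower = ℚ.*-cancelʳ-≤-pos (M * M) {{ℚ.positive M⁺}}
        (subst₂ _≤_ (trans (ι-* k k) (trans (cong₂ _*_ (sym rM) (sym rM))
            (solve 2 (λ r m → (r :* m) :* (r :* m) := (r :* r) :* (m :* m)) refl r M)))
          (sym qMM) (ι-≤ (k ℕ.* k) N (isqrt-lower N)))

      s = r + unit n

      sM : s * M ≡ ι (k ℕ.+ suc b)
      sM = trans (ℚ.*-distribʳ-+ M r (unit n)) (trans
        (cong₂ _+_ rM (trans (cong (unit n *_) (trans (cong ι (ℕ.*-comm (suc b) (suc n))) (ι-* (suc n) (suc b))))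
          (trans (sym (ℚ.*-assoc (unit n) (ι (suc n)) (ι (suc b))))
            (trans (cong (_* ι (suc b)) (clear-/ 1 n)) (ℚ.*-identityˡ (ι (suc b)))))))
        (sym (ι-+ k (suc b))))

      upper : q < s * s
      upper = ℚ.*-cancelʳ-<-nonNeg (M * M) {{ℚ.nonNegative (ℚ.<⇒≤ M⁺)}}
        (subst₂ _<_ (sym qMM) (trans (ι-* (k ℕ.+ suc b) (k ℕ.+ suc b)) (trans (cong₂ _*_ (sym sM) (sym sM))
            (solve 2 (λ r m → (r :* m) :* (r :* m) := (r :* r) :* (m :* m)) refl s M)))
          (ι-< N ((k ℕ.+ suc b) ℕ.* (k ℕ.+ suc b)) (ℕ.<-≤-trans (isqrt-upper N) (ℕ.*-mono-≤ k<k+ k<k+))))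
        where
        k<k+ : suc k ℕ.≤ k ℕ.+ suc b
        k<k+ = ℕ.≤-trans (ℕ.s≤s (ℕ.m≤m+n k b)) (ℕ.≤-reflexive (sym (ℕ.+-suc k b)))

      nonneg : 0ℚ ≤ r
      nonneg = ℚ.*-cancelʳ-≤-pos M {{ℚ.positive (ι-pos (n ℕ.+ b ℕ.* suc n))}}
        (subst₂ _≤_ (sym (ℚ.*-zeroˡ M)) (sym rM) (ι-≤ 0 k ℕ.z≤n))

  sqrtℚ-spec : ∀ n q → 0ℚ ≤ q → 0ℚ ≤ sqrtℚ n q × sqrtℚ n q * sqrtℚ n q ≤ q
                              × q < (sqrtℚ n q + unit n) * (sqrtℚ n q + unit n)
  sqrtℚ-spec n (mkℚ (+ a) b c) _ = Approx.nonneg n a b c , Approx.lower n a b c , Approx.upper n a b c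
  sqrtℚ-spec n (mkℚ -[1+ a ] b c) 0≤q = ⊥-elim (ℤ.≤⇒≯ (ℚ.drop-*≤* 0≤q) ℤ.-<+)

record ℝ : Set where
  constructor real
  field
    seq    : ℕ → ℚ
    cauchy : ∀ ε → 0ℚ ℚ.< ε → ∃ λ N → ∀ m n → N ℕ.≤ m → N ℕ.≤ n →
             ℚ.∣ seq m ℚ.- seq n ∣ ℚ.< ε
open ℝ public

infix  4 _<_ _≤_ _≃_

_<_ : ℝ → ℝ → Set
x < y = ∃ λ ε → 0ℚ ℚ.< ε × ∃ λ N → ∀ n → N ℕ.≤ n → seq x n ℚ.+ ε ℚ.< seq y n

_≤_ : ℝ → ℝ → Set
x ≤ y = ∀ ε → 0ℚ ℚ.< ε → ∃ λ N → ∀ n → N ℕ.≤ n → seq x n ℚ.< seq y n ℚ.+ ε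

_≃_ : ℝ → ℝ → Set
x ≃ y = x ≤ y × y ≤ x

module _ where
  open Rational
  open +-*-Solver using (solve; _:=_; _:+_; _:*_; _:-_; :-_; con)

  infixl 6 _+_ _-_
  infixl 7 _*_
  infix  8 -_
  infixr 9 _^_

  fromℚ : ℚ → ℝ
  fromℚ q = real (λ _ → q) λ ε 0<ε → 0 , λ _ _ _ _ →
    subst (ℚ._< ε) (sym (cong ℚ.∣_∣ (ℚ.+-inverseʳ q))) 0<ε

  _+_ : ℝ → ℝ → ℝ
  seq (x + y) n = seq x n ℚ.+ seq y n
  cauchy (x + y) ε 0<ε =
    let (M , f) = cauchy x (½ ℚ.* ε) (half-pos 0<ε)
        (N , g) = cauchy y (½ ℚ.* ε) (half-pos 0<ε)
    in M ℕ.⊔ N , λ m n M≤m M≤n →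
      ℚ.≤-<-trans
        (subst (ℚ._≤ ℚ.∣ seq x m ℚ.- seq x n ∣ ℚ.+ ℚ.∣ seq y m ℚ.- seq y n ∣)
          (cong ℚ.∣_∣ (solve 4 (λ a b c d → (a :- b) :+ (c :- d) := (a :+ c) :- (b :+ d)) refl
            (seq x m) (seq x n) (seq y m) (seq y n)))
          (ℚ.∣p+q∣≤∣p∣+∣q∣ (seq x m ℚ.- seq x n) (seq y m ℚ.- seq y n)))
        (subst (ℚ.∣ seq x m ℚ.- seq x n ∣ ℚ.+ ℚ.∣ seq y m ℚ.- seq y n ∣ ℚ.<_) (halve ε)
          (ℚ.+-mono-< (f m n (ℕ.m⊔n≤o⇒m≤o M N M≤m) (ℕ.m⊔n≤o⇒m≤o M N M≤n))
                      (g m n (ℕ.m⊔n≤o⇒n≤o M N M≤m) (ℕ.m⊔n≤o⇒n≤o M N M≤n))))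

  -_ : ℝ → ℝ
  seq (- x) n = ℚ.- seq x n
  cauchy (- x) ε 0<ε = let (N , f) = cauchy x ε 0<ε in N , λ m n N≤m N≤n →
    subst (ℚ._< ε) (trans (abs-sym (seq x m) (seq x n))
        (cong ℚ.∣_∣ (solve 2 (λ a b → b :- a := :- a :- :- b) refl (seq x m) (seq x n))))
      (f m n N≤m N≤n)

  _-_ : ℝ → ℝ → ℝ
  x - y = x + (- y)

  ∣_∣ : ℝ → ℝ
  seq ∣ x ∣ n = ℚ.∣ seq x n ∣
  cauchy ∣ x ∣ ε 0<ε = let (N , f) = cauchy x ε 0<ε in N , λ m n N≤m N≤n →
    ℚ.≤-<-trans (abs-nonexpanding (seq x m) (seq x n)) (f m n N≤m N≤n)

  bounded : ∀ x → ∃ λ B → 0ℚ ℚ.< B × ∃ λ N → ∀ n → N ℕ.≤ n → ℚ.∣ seq x n ∣ ℚ.≤ B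
  bounded x =
    let (N , f) = cauchy x 1ℚ (ℚ.positive⁻¹ 1ℚ)
        0<B = subst (ℚ._< 1ℚ ℚ.+ ℚ.∣ seq x N ∣) (ℚ.+-identityˡ 0ℚ)
                (ℚ.+-mono-<-≤ (ℚ.positive⁻¹ 1ℚ) (ℚ.0≤∣p∣ (seq x N)))
    in 1ℚ ℚ.+ ℚ.∣ seq x N ∣ , 0<B , N , λ n N≤n →
      ℚ.≤-trans
        (subst (λ z → ℚ.∣ z ∣ ℚ.≤ ℚ.∣ seq x n ℚ.- seq x N ∣ ℚ.+ ℚ.∣ seq x N ∣)
          (solve 2 (λ a b → (a :- b) :+ b := a) refl (seq x n) (seq x N))
          (ℚ.∣p+q∣≤∣p∣+∣q∣ (seq x n ℚ.- seq x N) (seq x N)))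
        (ℚ.+-monoˡ-≤ ℚ.∣ seq x N ∣ (ℚ.<⇒≤ (f n N N≤n ℕ.≤-refl)))

  _*_ : ℝ → ℝ → ℝ
  seq (x * y) n = seq x n ℚ.* seq y n
  cauchy (x * y) ε 0<ε =
    let (B , 0<B , K , bx) = bounded x
        (C , 0<C , L , by) = bounded y
        (δ , 0<δ , Bδ) = divide 0<B (half-pos 0<ε)
        (η , 0<η , Cη) = divide 0<C (half-pos 0<ε)
        (M , f) = cauchy x η 0<η
        (N , g) = cauchy y δ 0<δ
    in (K ℕ.⊔ L) ℕ.⊔ (M ℕ.⊔ N) , λ m n ≤m ≤n →
      let KL≤m = ℕ.m⊔n≤o⇒m≤o (K ℕ.⊔ L) (M ℕ.⊔ N) ≤m
          MN≤m = ℕ.m⊔n≤o⇒n≤o (K ℕ.⊔ L) (M ℕ.⊔ N) ≤m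
          KL≤n = ℕ.m⊔n≤o⇒m≤o (K ℕ.⊔ L) (M ℕ.⊔ N) ≤n
          MN≤n = ℕ.m⊔n≤o⇒n≤o (K ℕ.⊔ L) (M ℕ.⊔ N) ≤n
          a = seq x m ; b = seq x n ; c = seq y m ; d = seq y n
      in subst₂ ℚ._<_
           (cong ℚ.∣_∣ (solve 4 (λ a b c d → a :* (c :- d) :+ d :* (a :- b) := a :* c :- b :* d) refl a b c d))
           (halve ε)
           (ℚ.≤-<-trans (ℚ.∣p+q∣≤∣p∣+∣q∣ (a ℚ.* (c ℚ.- d)) (d ℚ.* (a ℚ.- b)))
             (ℚ.+-mono-<
               (small 0<B Bδ (bx m (ℕ.m⊔n≤o⇒m≤o K L KL≤m))
                  (g m n (ℕ.m⊔n≤o⇒n≤o M N MN≤m) (ℕ.m⊔n≤o⇒n≤o M N MN≤n)))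
               (small 0<C Cη (by n (ℕ.m⊔n≤o⇒n≤o K L KL≤n))
                  (f m n (ℕ.m⊔n≤o⇒m≤o M N MN≤m) (ℕ.m⊔n≤o⇒m≤o M N MN≤n)))))
    where
    small : ∀ {B δ e u v} → 0ℚ ℚ.< B → B ℚ.* δ ≡ e → ℚ.∣ u ∣ ℚ.≤ B → ℚ.∣ v ∣ ℚ.< δ →
            ℚ.∣ u ℚ.* v ∣ ℚ.< e
    small {B} {δ} {e} {u} {v} 0<B eq u≤B v<δ =
      subst₂ ℚ._<_ (sym (ℚ.∣p*q∣≡∣p∣*∣q∣ u v)) eq
        (ℚ.≤-<-trans (ℚ.*-monoʳ-≤-nonNeg ℚ.∣ v ∣ {{ℚ.nonNegative (ℚ.0≤∣p∣ v)}} u≤B)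
                     (ℚ.*-monoʳ-<-pos B {{ℚ.positive 0<B}} v<δ))

  _^_ : ℝ → ℕ → ℝ
  x ^ zero  = fromℚ 1ℚ
  x ^ suc n = x * x ^ n

  -- A total square root: √ x is the square root of max(0, x).
  √ : ℝ → ℝ
  seq (√ x) n = sqrtℚ n (0ℚ ℚ.⊔ seq x n)
  cauchy (√ x) ε 0<ε =
    let e = ½ ℚ.* ε
        0<e = half-pos 0<ε
        (M , f) = cauchy x (e ℚ.* e) (*-pos 0<e 0<e)
        (N , g) = archimedean 0<e
        step : ∀ m n → M ℕ.⊔ N ℕ.≤ m → M ℕ.⊔ N ℕ.≤ n → seq (√ x) m ℚ.< seq (√ x) n ℚ.+ ε
        step m n ≤m ≤n = close 0<e 0<ε (halve ε) n m (seq x n) (seq x m)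
          (near (f m n (ℕ.m⊔n≤o⇒m≤o M N ≤m) (ℕ.m⊔n≤o⇒m≤o M N ≤n)))
          (g n (ℕ.m⊔n≤o⇒n≤o M N ≤n))
    in M ℕ.⊔ N , λ m n ≤m ≤n → near⁻¹ (step m n ≤m ≤n) (step n m ≤n ≤m)
    where
    close : ∀ {e ε} → 0ℚ ℚ.< e → 0ℚ ℚ.< ε → e ℚ.+ e ≡ ε → ∀ n m p q → q ℚ.< p ℚ.+ e ℚ.* e →
            unit n ℚ.≤ e → sqrtℚ m (0ℚ ℚ.⊔ q) ℚ.< sqrtℚ n (0ℚ ℚ.⊔ p) ℚ.+ ε
    close {e} {ε} 0<e 0<ε refl n m p q q<p+e² u≤e =
      let r = sqrtℚ n (0ℚ ℚ.⊔ p)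
          u = unit n
          (0≤r , _ , hi) = sqrtℚ-spec n (0ℚ ℚ.⊔ p) (ℚ.p≤p⊔q 0ℚ p)
          (_ , lo , _)   = sqrtℚ-spec m (0ℚ ℚ.⊔ q) (ℚ.p≤p⊔q 0ℚ q)
          0≤e = ℚ.<⇒≤ 0<e
          0≤u = ℚ.<⇒≤ (unit-pos n)
          0≤r+e = +-nonneg 0≤r 0≤e
          0≤r+u = +-nonneg 0≤r 0≤u
          r+u≤r+e = ℚ.+-monoʳ-≤ r u≤e
      in sq-cancel (+-nonneg 0≤r (ℚ.<⇒≤ 0<ε))
        (ℚ.≤-<-trans lo (ℚ.<-≤-trans (pos-nonexpanding {q} {p} (*-pos 0<e 0<e) q<p+e²)
          (ℚ.≤-trans (ℚ.+-monoˡ-≤ (e ℚ.* e) (ℚ.≤-trans (ℚ.<⇒≤ hi) (*-mono 0≤r+u 0≤r+e r+u≤r+e r+u≤r+e)))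
            (subst₂ ℚ._≤_ (ℚ.+-identityʳ _)
              (solve 2 (λ s e → (s :* s :+ e :* e) :+ (s :* e :+ s :* e) := (s :+ e) :* (s :+ e)) refl
                 (r ℚ.+ e) e ■ cong (λ z → z ℚ.* z) (ℚ.+-assoc r e e))
              (ℚ.+-monoʳ-≤ ((r ℚ.+ e) ℚ.* (r ℚ.+ e) ℚ.+ e ℚ.* e)
                (+-nonneg (*-nonneg 0≤r+e 0≤e) (*-nonneg 0≤r+e 0≤e)))))))
      where _■_ = trans

  √-nonneg : ∀ x → fromℚ 0ℚ ≤ √ x
  √-nonneg x ε 0<ε = 0 , λ n _ →
    let (0≤r , _) = sqrtℚ-spec n (0ℚ ℚ.⊔ seq x n) (ℚ.p≤p⊔q 0ℚ (seq x n))
    in subst (ℚ._< seq (√ x) n ℚ.+ ε) (ℚ.+-identityˡ 0ℚ) (ℚ.+-mono-≤-< 0≤r 0<ε)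

  √-square : ∀ x → fromℚ 0ℚ ≤ x → √ x * √ x ≃ x
  √-square x 0≤x = below , above
    where
    spec = λ n → sqrtℚ-spec n (0ℚ ℚ.⊔ seq x n) (ℚ.p≤p⊔q 0ℚ (seq x n))

    -- 0 ⊔ x < x + ε eventually, since -ε < x eventually
    below : √ x * √ x ≤ x
    below ε 0<ε =
      let (N , f) = 0≤x ε 0<ε
      in N , λ n N≤n → ℚ.≤-<-trans (proj₁ (proj₂ (spec n)))
           ([ (λ eq → subst (ℚ._< seq x n ℚ.+ ε) (sym eq) (f n N≤n))
            , (λ eq → subst (ℚ._< seq x n ℚ.+ ε) (sym eq)
                 (subst (ℚ._< seq x n ℚ.+ ε) (ℚ.+-identityʳ (seq x n)) (ℚ.+-monoʳ-< (seq x n) 0<ε)))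
            ]′ (ℚ.⊔-sel 0ℚ (seq x n)))

    -- (r + u)² ≤ r² + (2B + 1) u when r ≤ B and 0 ≤ u ≤ 1
    above : x ≤ √ x * √ x
    above ε 0<ε =
      let (B , 0<B , K , br) = bounded (√ x)
          c = B ℚ.+ B ℚ.+ 1ℚ
          0<c = ℚ.<-trans (ℚ.positive⁻¹ 1ℚ) (subst (ℚ._< c) (ℚ.+-identityˡ 1ℚ)
                  (ℚ.+-monoˡ-< 1ℚ (+-pos 0<B 0<B)))
          (δ , 0<δ , cδ) = divide 0<c 0<ε
          (N , g) = archimedean 0<δ
      in K ℕ.⊔ N , λ n ≤n →
        let r = seq (√ x) n ; u = unit n
            r≤B = ℚ.≤-trans (≤abs r) (br n (ℕ.m⊔n≤o⇒m≤o K N ≤n))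
            u≤δ = g n (ℕ.m⊔n≤o⇒n≤o K N ≤n)
            0≤u = ℚ.<⇒≤ (unit-pos n)
            r+r+u≤c = ℚ.+-mono-≤ (ℚ.+-mono-≤ r≤B r≤B) (unit≤1 n)
        in ℚ.≤-<-trans (ℚ.p≤q⊔p 0ℚ (seq x n)) (ℚ.<-≤-trans (proj₂ (proj₂ (spec n)))
             (subst (ℚ._≤ r ℚ.* r ℚ.+ ε)
               (solve 2 (λ r u → r :* r :+ (r :+ r :+ u) :* u := (r :+ u) :* (r :+ u)) refl r u)
               (ℚ.+-monoʳ-≤ (r ℚ.* r)
                 (ℚ.≤-trans (ℚ.*-monoʳ-≤-nonNeg u {{ℚ.nonNegative 0≤u}} r+r+u≤c)
                   (subst (c ℚ.* u ℚ.≤_) cδ (ℚ.*-monoˡ-≤-nonNeg c {{ℚ.nonNegative (ℚ.<⇒≤ 0<c)}} u≤δ))))))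

Series : Set
Series = ℕ → ℚ

infixl 6 _+ˢ_ _-ˢ_
infixl 7 _*ˢ_
infix  9 _²
infix  4 _IsSqrtOf_

Σℚ : ℕ → (ℕ → ℚ) → ℚ
Σℚ zero    f = 0ℚ
Σℚ (suc n) f = Σℚ n f ℚ.+ f n

_+ˢ_ _-ˢ_ _*ˢ_ : Series → Series → Series
(a +ˢ b) n = a n ℚ.+ b n
(a -ˢ b) n = a n ℚ.- b n
(a *ˢ b) n = Σℚ (suc n) (λ k → a k ℚ.* b (n ℕ.∸ k))

const : ℕ → Series
const c zero    = ι c
const c (suc n) = 0ℚ

var : Series
var 1 = 1ℚ
var _ = 0ℚ

_² : Series → Series
a ² = a *ˢ a

-- The square root of a power series with constant term 1 is the one which
-- itself has constant term 1.
_IsSqrtOf_ : Series → Series → Set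
s IsSqrtOf a = s 0 ≡ 1ℚ × (∀ n → (s ²) n ≡ a n)

genFun : (ℕ → ℕ) → Series
genFun a n = ι (a n)

partialSum : Series → ℝ → ℕ → ℝ
partialSum a t zero    = fromℚ 0ℚ
partialSum a t (suc n) = partialSum a t n + fromℚ (a n) * t ^ n

HasSum : Series → ℝ → ℝ → Set
HasSum a t y = ∀ ε → 0ℚ ℚ.< ε → ∃ λ N → ∀ n → N ℕ.≤ n →
  ∣ partialSum a t n - y ∣ < fromℚ ε

Converges : Series → ℝ → Set
Converges a t = ∃ λ y → HasSum a t y

-- Only finite radii are representable.
RadiusOfConvergence : Series → ℝ → Set
RadiusOfConvergence a r =
    fromℚ 0ℚ ≤ r
  × (∀ t → ∣ t ∣ < r → Converges a t)
  × (∀ t → r < ∣ t ∣ → ¬ Converges a t)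

-- lim_{t → c⁻} f t = L for a partial function f given by its graph.  As usual for
-- limits of functions that are not defined everywhere, c has to be a limit
-- point (from the left) of the domain of f: the first component.
LeftLimit : (ℝ → ℝ → Set) → ℝ → ℝ → Set
LeftLimit f c L =
    (∀ δ → 0ℚ ℚ.< δ → ∃ λ t → ∃ λ y → c - fromℚ δ < t × t < c × f t y)
  × (∀ ε → 0ℚ ℚ.< ε → ∃ λ δ → 0ℚ ℚ.< δ ×
       (∀ t y → c - fromℚ δ < t → t < c → f t y → ∣ y - L ∣ < fromℚ ε))

P D : Series
P = genFun numParallel
D = genFun numDeque

discriminant : Series
discriminant =
  const 1 -ˢ const 4 *ˢ P +ˢ const 4 *ˢ P ² -ˢ const 8 *ˢ P ² *ˢ var
          +ˢ const 4 *ˢ P ² *ˢ var ² -ˢ const 4 *ˢ P *ˢ var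

DequeEquation : Set
DequeEquation = ∃ λ S → S IsSqrtOf discriminant ×
  (∀ n → (const 2 *ˢ D) n ≡
    (const 2 +ˢ var +ˢ const 2 *ˢ P *ˢ var -ˢ const 2 *ˢ P *ˢ var ² -ˢ var *ˢ S) n)

{-# OPTIONS --safe #-}
-- Put a = 2P(t) and b = 2tP(t).  The radicand of the deque equation is Källén's function
--   (a - b)² - 2(a + b) + 1 = ((√a - √b)² - 1)((√a + √b)² - 1).
-- By that equation t times the square root of the radicand is a power series built from P and D,
-- so it converges on [0,tc) and t² times the radicand, being the square of its sum, is nonnegative
-- there.  As P(t) ≥ 1 gives √a > 1, the second factor is positive (as is t if √a < 1 + √b), whence
-- |√a - √b| ≥ 1; and √a ≥ √b because t ≤ 1.  The closed conditions t² · radicand ≥ 0, P(t) ≥ 1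
-- and t ≤ 1 pass to the limit t → tc.  Constructively the case distinctions are harmless, since
-- ≤ on the reals is stable under double negation.
module Submission where

open import Defs
open import Data.Nat as ℕ using (ℕ; zero; suc)
import Data.Nat.Properties as ℕ
open import Data.Rational as ℚ using (ℚ; 0ℚ; 1ℚ; ½)
import Data.Rational.Properties as ℚ
open import Data.Rational.Solver using (module +-*-Solver)
open import Data.Product using (∃; _×_; _,_; proj₁; proj₂)
open import Data.Sum using (inj₁; inj₂)
open import Data.Empty using (⊥)
open import Relation.Binary.PropositionalEquality
  using (_≡_; _≗_; refl; sym; trans; cong; cong₂; subst; subst₂)
open import Relation.Nullary using (¬_; yes; no; contradiction)
open Rational using (divide; half-pos; halve; near; near⁻¹; ≤abs; abs-sym; archimedean;
  unit; unit-pos; *-nonneg)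
open +-*-Solver using (solve; _:=_; _:+_; _:*_; _:-_; :-_; con)

-- Rational estimates and properties that hold eventually.

<+ : ∀ a {e} → 0ℚ ℚ.< e → a ℚ.< a ℚ.+ e
<+ a {e} 0<e = subst (ℚ._< a ℚ.+ e) (ℚ.+-identityʳ a) (ℚ.+-monoʳ-< a 0<e)

∣∣-* : ∀ {p q B C} → ℚ.∣ p ∣ ℚ.≤ B → ℚ.∣ q ∣ ℚ.≤ C → ℚ.∣ p ℚ.* q ∣ ℚ.≤ B ℚ.* C
∣∣-* {p} {q} p≤B q≤C = subst (ℚ._≤ _) (sym (ℚ.∣p*q∣≡∣p∣*∣q∣ p q))
  (Rational.*-mono (ℚ.0≤∣p∣ p) (ℚ.≤-trans (ℚ.0≤∣p∣ q) q≤C) p≤B q≤C)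

sum-error : ∀ a b x y {ε} → ℚ.∣ a ℚ.- x ∣ ℚ.< ½ ℚ.* ε → ℚ.∣ b ℚ.- y ∣ ℚ.< ½ ℚ.* ε →
  ℚ.∣ (a ℚ.+ b) ℚ.- (x ℚ.+ y) ∣ ℚ.< ε
sum-error a b x y {ε} a~x b~y = subst (ℚ.∣ (a ℚ.+ b) ℚ.- (x ℚ.+ y) ∣ ℚ.<_) (halve ε)
  (ℚ.≤-<-trans (subst (λ z → ℚ.∣ z ∣ ℚ.≤ ℚ.∣ a ℚ.- x ∣ ℚ.+ ℚ.∣ b ℚ.- y ∣)
      (solve 4 (λ a b x y → (a :- x) :+ (b :- y) := (a :+ b) :- (x :+ y)) refl a b x y)
      (ℚ.∣p+q∣≤∣p∣+∣q∣ (a ℚ.- x) (b ℚ.- y)))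
    (ℚ.+-mono-< a~x b~y))

Eventually : (ℕ → Set) → Set
Eventually A = ∃ λ N → ∀ n → N ℕ.≤ n → A n

mapᵉ : ∀ {A B : ℕ → Set} → (∀ {n} → A n → B n) → Eventually A → Eventually B
mapᵉ f (N , a) = N , λ n N≤n → f (a n N≤n)

zipᵉ : ∀ {A B C : ℕ → Set} → (∀ {n} → A n → B n → C n) →
       Eventually A → Eventually B → Eventually C
zipᵉ f (M , a) (N , b) = M ℕ.⊔ N , λ n ≤n →
  f (a n (ℕ.m⊔n≤o⇒m≤o M N ≤n)) (b n (ℕ.m⊔n≤o⇒n≤o M N ≤n))

always : ∀ {A : ℕ → Set} → (∀ n → A n) → Eventually A
always a = 0 , λ n _ → a n

witness : ∀ {A : ℕ → Set} → Eventually A → ∃ A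
witness (N , a) = N , a N ℕ.≤-refl

half< : ∀ {e} → 0ℚ ℚ.< e → ½ ℚ.* e ℚ.< e
half< {e} 0<e = subst (½ ℚ.* e ℚ.<_) (halve e) (<+ (½ ℚ.* e) (half-pos 0<e))

⊓-pos : ∀ {d e} → 0ℚ ℚ.< d → 0ℚ ℚ.< e → 0ℚ ℚ.< d ℚ.⊓ e
⊓-pos {d} {e} 0<d 0<e with ℚ.⊓-sel d e
... | inj₁ eq = subst (0ℚ ℚ.<_) (sym eq) 0<d
... | inj₂ eq = subst (0ℚ ℚ.<_) (sym eq) 0<e

near-bounds : ∀ {a b e} → ℚ.∣ a ℚ.- b ∣ ℚ.< e → a ℚ.< b ℚ.+ e × b ℚ.< a ℚ.+ e
near-bounds {a} {b} lt = near lt , near (subst (ℚ._< _) (abs-sym a b) lt)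

-- With u = a - x and v = b - y one has ab - xy = uv + (xv + uy); since |u| < η ≤ 1, the quadratic
-- term costs only one more η.
product-error : ∀ a b x y {B C η ε} →
  ℚ.∣ x ∣ ℚ.≤ B → ℚ.∣ y ∣ ℚ.≤ C → η ℚ.≤ 1ℚ →
  (1ℚ ℚ.+ (B ℚ.+ C)) ℚ.* η ℚ.< ε →
  ℚ.∣ a ℚ.- x ∣ ℚ.< η → ℚ.∣ b ℚ.- y ∣ ℚ.< η →
  ℚ.∣ a ℚ.* b ℚ.- x ℚ.* y ∣ ℚ.< ε
product-error a b x y {B} {C} {η} {ε} x≤B y≤C η≤1 small a~x b~y =
  ℚ.≤-<-trans (subst (λ z → ℚ.∣ z ∣ ℚ.≤ _)
      (solve 4 (λ a b x y → (a :- x) :* (b :- y) :+ (x :* (b :- y) :+ (a :- x) :* y)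
                            := a :* b :- x :* y) refl a b x y)
      (ℚ.≤-trans (ℚ.∣p+q∣≤∣p∣+∣q∣ (u ℚ.* v) (x ℚ.* v ℚ.+ u ℚ.* y))
        (ℚ.+-mono-≤ (∣∣-* {u} {v} (ℚ.≤-trans (ℚ.<⇒≤ a~x) η≤1) (ℚ.<⇒≤ b~y))
          (ℚ.≤-trans (ℚ.∣p+q∣≤∣p∣+∣q∣ (x ℚ.* v) (u ℚ.* y))
            (ℚ.+-mono-≤ (∣∣-* {x} {v} x≤B (ℚ.<⇒≤ b~y)) (∣∣-* {u} {y} (ℚ.<⇒≤ a~x) y≤C))))))
    (subst (ℚ._< ε)
      (solve 3 (λ B C η → (con 1ℚ :+ (B :+ C)) :* η := con 1ℚ :* η :+ (B :* η :+ η :* C)) refl B C η)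
      small)
  where
  u = a ℚ.- x
  v = b ℚ.- y

-- Limits

Close : ℚ → (ℕ → ℚ) → (ℕ → ℚ) → Set
Close ε x y = Eventually λ k → ℚ.∣ x k ℚ.- y k ∣ ℚ.< ε

Bounded : (ℕ → ℚ) → Set
Bounded x = ∃ λ B → 0ℚ ℚ.< B × Eventually λ k → ℚ.∣ x k ∣ ℚ.≤ B

infix 4 _⟶_

-- u n and x are the rational sequences underlying a sequence of reals and its limit; of their
-- being Cauchy only the boundedness of the limit is needed.
record _⟶_ (u : ℕ → ℕ → ℚ) (x : ℕ → ℚ) : Set where
  constructor lim
  field
    eventually-close : ∀ ε → 0ℚ ℚ.< ε → Eventually λ n → Close ε (u n) x
    limit-bounded    : Bounded x
open _⟶_

strictly-close : ∀ x y {ε} → ∣ x - y ∣ < fromℚ ε → Close ε (seq x) (seq y)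
strictly-close x y {ε} (δ , 0<δ , ev) =
  mapᵉ (λ {k} → ℚ.<-trans (<+ ℚ.∣ seq x k ℚ.- seq y k ∣ 0<δ)) ev

⟶-refl : ∀ {x} → Bounded x → (λ _ → x) ⟶ x
⟶-refl {x} bd = lim (λ ε 0<ε → always λ _ → always λ k →
  subst (ℚ._< ε) (cong ℚ.∣_∣ (sym (ℚ.+-inverseʳ (x k)))) 0<ε) bd

⟶-const : ∀ q → (λ _ _ → q) ⟶ (λ _ → q)
⟶-const q = ⟶-refl
  (ℚ.∣ q ∣ ℚ.+ 1ℚ , ℚ.≤-<-trans (ℚ.0≤∣p∣ q) grow , always λ _ → ℚ.<⇒≤ grow)
  where
  grow = <+ ℚ.∣ q ∣ (ℚ.positive⁻¹ 1ℚ)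

⟶-+ : ∀ {u v x y} → u ⟶ x → v ⟶ y → (λ n k → u n k ℚ.+ v n k) ⟶ (λ k → x k ℚ.+ y k)
⟶-+ {u} {v} {x} {y} (lim u⟶x (B , 0<B , x≤B)) (lim v⟶y (C , 0<C , y≤C)) = lim
  (λ ε 0<ε →
    zipᵉ (λ {n} → zipᵉ λ {k} → sum-error (u n k) (v n k) (x k) (y k))
      (u⟶x (½ ℚ.* ε) (half-pos 0<ε)) (v⟶y (½ ℚ.* ε) (half-pos 0<ε)))
  (B ℚ.+ C , Rational.+-pos 0<B 0<C ,
    zipᵉ (λ {k} p q → ℚ.≤-trans (ℚ.∣p+q∣≤∣p∣+∣q∣ (x k) (y k)) (ℚ.+-mono-≤ p q)) x≤B y≤C)

⟶-neg : ∀ {u x} → u ⟶ x → (λ n k → ℚ.- u n k) ⟶ (λ k → ℚ.- x k)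
⟶-neg {u} {x} (lim u⟶x (B , 0<B , x≤B)) = lim
  (λ ε 0<ε → mapᵉ (λ {n} → mapᵉ λ {k} → subst (ℚ._< ε)
    (trans (abs-sym (u n k) (x k)) (cong ℚ.∣_∣
      (solve 2 (λ a b → b :- a := :- a :- :- b) refl (u n k) (x k))))) (u⟶x ε 0<ε))
  (B , 0<B , mapᵉ (λ {k} → subst (ℚ._≤ B) (sym (ℚ.∣-p∣≡∣p∣ (x k)))) x≤B)

⟶-- : ∀ {u v x y} → u ⟶ x → v ⟶ y → (λ n k → u n k ℚ.- v n k) ⟶ (λ k → x k ℚ.- y k)
⟶-- u⟶x v⟶y = ⟶-+ u⟶x (⟶-neg v⟶y)

⟶-* : ∀ {u v x y} → u ⟶ x → v ⟶ y → (λ n k → u n k ℚ.* v n k) ⟶ (λ k → x k ℚ.* y k)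
⟶-* {u} {v} {x} {y} (lim u⟶x (B , 0<B , x≤B)) (lim v⟶y (C , 0<C , y≤C)) = lim
  (λ ε 0<ε →
    let 0<c = Rational.+-pos (ℚ.positive⁻¹ 1ℚ) (Rational.+-pos 0<B 0<C)
        -- `δ` solves (1 + B + C) δ = ε/2; the factor 1/2 makes the final bound strict.
        (δ , 0<δ , eq) = divide 0<c (half-pos 0<ε)
        η = δ ℚ.⊓ 1ℚ
        0<η = ⊓-pos 0<δ (ℚ.positive⁻¹ 1ℚ)
        small = ℚ.≤-<-trans (ℚ.≤-trans
          (ℚ.*-monoˡ-≤-nonNeg (1ℚ ℚ.+ (B ℚ.+ C)) {{ℚ.nonNegative (ℚ.<⇒≤ 0<c)}} (ℚ.p⊓q≤p δ 1ℚ))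
          (ℚ.≤-reflexive eq)) (half< 0<ε)
    in zipᵉ (λ {n} p q → zipᵉ (λ { {k} (a~x , b~y) (x≤B , y≤C) →
           product-error (u n k) (v n k) (x k) (y k)
             x≤B y≤C (ℚ.p⊓q≤q δ 1ℚ) small a~x b~y })
         (zipᵉ _,_ p q) (zipᵉ _,_ x≤B y≤C))
       (u⟶x η 0<η) (v⟶y η 0<η))
  (B ℚ.* C , Rational.*-pos 0<B 0<C , zipᵉ (λ {k} → ∣∣-* {x k} {y k}) x≤B y≤C)

-- Order

record NonNeg (x : ℕ → ℚ) : Set where
  constructor nonNeg
  field 0≤ : ∀ ε → 0ℚ ℚ.< ε → Eventually λ k → 0ℚ ℚ.< x k ℚ.+ ε
open NonNeg

record Pos (x : ℕ → ℚ) : Set where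
  constructor pos
  field 0< : ∃ λ ε → 0ℚ ℚ.< ε × Eventually λ k → ε ℚ.< x k

module _ {x y : ℝ} where
  ≤⇒NonNeg : x ≤ y → NonNeg (λ k → seq y k ℚ.- seq x k)
  ≤⇒NonNeg x≤y = nonNeg λ ε 0<ε → mapᵉ (λ {k} lt → subst₂ ℚ._<_
    (ℚ.+-inverseʳ (seq x k))
    (solve 3 (λ x y e → y :+ e :- x := y :- x :+ e) refl (seq x k) (seq y k) ε)
    (ℚ.+-monoˡ-< (ℚ.- seq x k) lt)) (x≤y ε 0<ε)

  <⇒Pos : x < y → Pos (λ k → seq y k ℚ.- seq x k)
  <⇒Pos (ε , 0<ε , ev) = pos (ε , 0<ε , mapᵉ (λ {k} lt → subst (ℚ._< seq y k ℚ.- seq x k)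
    (solve 2 (λ x e → (x :+ e) :- x := e) refl (seq x k) ε)
    (ℚ.+-monoˡ-< (ℚ.- seq x k) lt)) ev)

  -- If x and y are 4δ apart at an index from which on both vary by less than δ,
  -- then they stay apart; otherwise they stay within 6δ.
  ≮⇒≥ : ¬ y < x → x ≤ y
  ≮⇒≥ y≮x ε 0<ε =
    -- `δ` is ε/8: the first branch of `separate` spends six of them and pads with two. `separate`
    -- takes `δ` as a variable with an equation, so that the ring solver sees an atom.
    let δ = ½ ℚ.* (½ ℚ.* (½ ℚ.* ε))
        0<δ = half-pos (half-pos (half-pos 0<ε))
        (M , f) = cauchy x δ 0<δ
        (N , g) = cauchy y δ 0<δ
        K = M ℕ.⊔ N
    in K , λ n K≤n → separate δ 0<δ K
      (λ n K≤n → f n K (ℕ.≤-trans (ℕ.m≤m⊔n M N) K≤n) (ℕ.m≤m⊔n M N))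
      (λ n K≤n → g n K (ℕ.≤-trans (ℕ.m≤n⊔m M N) K≤n) (ℕ.m≤n⊔m M N)) refl n K≤n
    where
    separate : ∀ δ → 0ℚ ℚ.< δ → ∀ K →
      (∀ n → K ℕ.≤ n → ℚ.∣ seq x n ℚ.- seq x K ∣ ℚ.< δ) →
      (∀ n → K ℕ.≤ n → ℚ.∣ seq y n ℚ.- seq y K ∣ ℚ.< δ) →
      ½ ℚ.* (½ ℚ.* (½ ℚ.* ε)) ≡ δ → ∀ n → K ℕ.≤ n → seq x n ℚ.< seq y n ℚ.+ ε
    separate δ 0<δ K x~ y~ eq n K≤n with seq x K ℚ.<? seq y K ℚ.+ (δ ℚ.+ δ ℚ.+ δ ℚ.+ δ)
    ... | yes lt =
      let a = proj₁ (near-bounds {seq x n} {seq x K} (x~ n K≤n))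
          b = proj₂ (near-bounds {seq y n} {seq y K} (y~ n K≤n))
          2δ>0 = Rational.+-pos 0<δ 0<δ
      in ℚ.<-trans a (subst (seq x K ℚ.+ δ ℚ.<_)
           (trans (solve 2 (λ y d → y :+ d :+ (d :+ d :+ d :+ d) :+ d :+ (d :+ d) :=
                             y :+ (d :+ d :+ d :+ d :+ d :+ d :+ d :+ d)) refl (seq y n) δ)
             (cong (seq y n ℚ.+_) (trans (cong (λ d → d ℚ.+ d ℚ.+ d ℚ.+ d ℚ.+ d ℚ.+ d ℚ.+ d ℚ.+ d) (sym eq))
                (solve 1 (λ e → let d = con ½ :* (con ½ :* (con ½ :* e)) in
                   d :+ d :+ d :+ d :+ d :+ d :+ d :+ d := e) refl ε))))
           (ℚ.<-trans (ℚ.+-monoˡ-< δ (ℚ.<-trans lt (ℚ.+-monoˡ-< (δ ℚ.+ δ ℚ.+ δ ℚ.+ δ) b)))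
             (<+ (seq y n ℚ.+ δ ℚ.+ (δ ℚ.+ δ ℚ.+ δ ℚ.+ δ) ℚ.+ δ) 2δ>0)))
    ... | no ≮ = contradiction (δ , 0<δ , K , apart) y≮x
      where
      apart : ∀ m → K ℕ.≤ m → seq y m ℚ.+ δ ℚ.< seq x m
      apart m K≤m =
        -- Here y(m) + 3δ < y(K) + 4δ ≤ x(K) < x(m) + δ, so subtracting δ leaves a gap of 2δ.
        let a = proj₂ (near-bounds {seq x m} {seq x K} (x~ m K≤m))
            b = proj₁ (near-bounds {seq y m} {seq y K} (y~ m K≤m))
            c = ℚ.<-trans (ℚ.+-monoˡ-< (δ ℚ.+ δ ℚ.+ δ) b)
                  (ℚ.≤-<-trans (ℚ.≤-reflexive (solve 2 (λ y d → y :+ d :+ (d :+ d :+ d) :=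
                       y :+ (d :+ d :+ d :+ d)) refl (seq y K) δ)) (ℚ.≤-<-trans (ℚ.≮⇒≥ ≮) a))
            d = ℚ.+-monoˡ-< (ℚ.- δ) c
        in ℚ.<-trans
             (subst₂ ℚ._<_ (ℚ.+-identityʳ _)
               (solve 2 (λ y d → y :+ d :+ d := y :+ (d :+ d :+ d) :- d) refl (seq y m) δ)
               (ℚ.+-monoʳ-< (seq y m ℚ.+ δ) 0<δ))
             (subst (seq y m ℚ.+ (δ ℚ.+ δ ℚ.+ δ) ℚ.- δ ℚ.<_)
               (solve 2 (λ x d → x :+ d :- d := x) refl (seq x m) δ) d)

Pos⇒< : ∀ x y → Pos (λ k → seq y k ℚ.- seq x k) → x < y
Pos⇒< x y (pos (ε , 0<ε , ev)) = ε , 0<ε , mapᵉ (λ {k} lt → subst₂ ℚ._<_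
  (ℚ.+-comm ε (seq x k))
  (solve 2 (λ x y → y :- x :+ x := y) refl (seq x k) (seq y k))
  (ℚ.+-monoˡ-< (seq x k) lt)) ev

≤⇒≯ : ∀ x y → x ≤ y → ¬ y < x
≤⇒≯ x y x≤y (ε , 0<ε , ev) =
  let (k , lt , gt) = witness (zipᵉ _,_ (x≤y ε 0<ε) ev) in ℚ.<-asym lt gt

-- Supplies case distinctions while a contradiction is sought: refuting a strict sign yields the
-- opposite weak one. It is stated for reals because arbitrary rational sequences may oscillate.
≯⇒NonNeg : ∀ x y → ¬ Pos (λ k → seq x k ℚ.- seq y k) → NonNeg (λ k → seq y k ℚ.- seq x k)
≯⇒NonNeg x y x≯y = ≤⇒NonNeg {x} {y} (≮⇒≥ {x} {y} λ y<x → x≯y (<⇒Pos {y} {x} y<x))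

nonNeg-pointwise : ∀ {x} → (∀ k → 0ℚ ℚ.≤ x k) → NonNeg x
nonNeg-pointwise {x} f = nonNeg λ ε 0<ε → always λ k →
  subst (ℚ._< x k ℚ.+ ε) (ℚ.+-identityˡ 0ℚ) (ℚ.+-mono-≤-< (f k) 0<ε)

Pos⇒NonNeg : ∀ {x} → Pos x → NonNeg x
Pos⇒NonNeg {x} (pos (δ , 0<δ , ev)) = nonNeg λ ε 0<ε → mapᵉ
  (λ {k} lt → Rational.+-pos (ℚ.<-trans 0<δ lt) 0<ε) ev

+-nonNeg : ∀ {x y} → NonNeg x → NonNeg y → NonNeg (λ k → x k ℚ.+ y k)
+-nonNeg {x} {y} (nonNeg 0≤x) (nonNeg 0≤y) = nonNeg λ ε 0<ε → zipᵉ
  (λ {k} a b → subst (0ℚ ℚ.<_)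
    (solve 3 (λ x y e → (x :+ con ½ :* e) :+ (y :+ con ½ :* e) := (x :+ y) :+ e) refl (x k) (y k) ε)
    (Rational.+-pos a b))
  (0≤x (½ ℚ.* ε) (half-pos 0<ε)) (0≤y (½ ℚ.* ε) (half-pos 0<ε))

+-pos : ∀ {x y} → Pos x → NonNeg y → Pos (λ k → x k ℚ.+ y k)
+-pos {x} {y} (pos (ε , 0<ε , ev)) (nonNeg 0≤y) = pos (½ ℚ.* ε , half-pos 0<ε , zipᵉ
  (λ {k} a b → subst₂ ℚ._<_
    (solve 1 (λ e → e :+ con 0ℚ :- con ½ :* e := con ½ :* e) refl ε)
    (solve 3 (λ x y e → x :+ (y :+ con ½ :* e) :- con ½ :* e := x :+ y) refl (x k) (y k) ε)
    (ℚ.+-monoˡ-< (ℚ.- (½ ℚ.* ε)) (ℚ.+-mono-< a b)))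
  ev (0≤y (½ ℚ.* ε) (half-pos 0<ε)))

*-pos : ∀ {x y} → Pos x → Pos y → Pos (λ k → x k ℚ.* y k)
*-pos {x} {y} (pos (δ , 0<δ , p)) (pos (ε , 0<ε , q)) = pos (δ ℚ.* ε , Rational.*-pos 0<δ 0<ε , zipᵉ
  (λ {k} δ<x ε<y → ℚ.<-≤-trans (ℚ.*-monoʳ-<-pos δ {{ℚ.positive 0<δ}} ε<y)
        (ℚ.*-monoʳ-≤-nonNeg (y k) {{ℚ.nonNegative (ℚ.<⇒≤ (ℚ.<-trans 0<ε ε<y))}} (ℚ.<⇒≤ δ<x)))
  p q)

Pos-pointwise : ∀ {x y} → (∀ k → x k ≡ y k) → Pos x → Pos y
Pos-pointwise eq (pos (ε , 0<ε , ev)) = pos (ε , 0<ε , mapᵉ (λ {k} → subst (ε ℚ.<_) (eq k)) ev)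

¬Pos-zero : ¬ Pos (λ _ → 0ℚ)
¬Pos-zero (pos (ε , 0<ε , ev)) = ℚ.<-asym 0<ε (proj₂ (witness ev))

-- A single `u n` within ε/2 of the limit suffices for each ε; this is how closed conditions pass to
-- limits.
⟶-nonNeg : ∀ {u x} → (∀ n → NonNeg (u n)) → u ⟶ x → NonNeg x
⟶-nonNeg {u} {x} f u⟶x = nonNeg λ ε 0<ε →
  let (n , close) = witness (eventually-close u⟶x (½ ℚ.* ε) (half-pos 0<ε))
  in zipᵉ (λ {k} a b → ℚ.<-trans a (subst (u n k ℚ.+ ½ ℚ.* ε ℚ.<_)
         (trans (ℚ.+-assoc (x k) (½ ℚ.* ε) (½ ℚ.* ε)) (cong (x k ℚ.+_) (halve ε)))
         (ℚ.+-monoˡ-< (½ ℚ.* ε) (proj₁ (near-bounds {u n k} {x k} b)))))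
       (0≤ (f n) (½ ℚ.* ε) (half-pos 0<ε)) close

-- Equality of reals and further limit laws.

infix 4 _≈_

-- Encoded as convergence of a constant sequence, so that the limit laws are also the congruence
-- laws of this relation.
_≈_ : (ℕ → ℚ) → (ℕ → ℚ) → Set
x ≈ y = (λ _ → x) ⟶ y

triangle : ∀ a b c {ε} → ℚ.∣ a ℚ.- b ∣ ℚ.< ½ ℚ.* ε → ℚ.∣ b ℚ.- c ∣ ℚ.< ½ ℚ.* ε → ℚ.∣ a ℚ.- c ∣ ℚ.< ε
triangle a b c {ε} p q = subst (λ z → ℚ.∣ z ∣ ℚ.< ε)
  (solve 3 (λ a b c → (a :+ b) :- (b :+ c) := a :- c) refl a b c) (sum-error a b b c p q)

-- A bound on `y` comes with `x ≈ y`; one on `x` follows from |x - y| < 1.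
≈-sym : ∀ {x y} → x ≈ y → y ≈ x
≈-sym {x} {y} (lim x≈y (B , 0<B , y≤B)) = lim
  (λ ε 0<ε → mapᵉ (mapᵉ λ {k} → subst (ℚ._< ε) (abs-sym (x k) (y k))) (x≈y ε 0<ε))
  (1ℚ ℚ.+ B , Rational.+-pos (ℚ.positive⁻¹ 1ℚ) 0<B ,
    zipᵉ (λ {k} lt y≤B → subst (λ z → ℚ.∣ z ∣ ℚ.≤ 1ℚ ℚ.+ B)
        (solve 2 (λ x y → x :- y :+ y := x) refl (x k) (y k))
        (ℚ.≤-trans (ℚ.∣p+q∣≤∣p∣+∣q∣ (x k ℚ.- y k) (y k)) (ℚ.+-mono-≤ (ℚ.<⇒≤ lt) y≤B)))
      (proj₂ (witness (x≈y 1ℚ (ℚ.positive⁻¹ 1ℚ)))) y≤B)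

⟶-respˡ : ∀ {u v x} → (∀ n → v n ≈ u n) → u ⟶ x → v ⟶ x
⟶-respˡ {u} {v} {x} eq (lim u⟶x bd) = lim (λ ε 0<ε → mapᵉ
  (λ {n} → zipᵉ (λ {k} → triangle (v n k) (u n k) (x k))
    (proj₂ (witness (eventually-close (eq n) (½ ℚ.* ε) (half-pos 0<ε)))))
  (u⟶x (½ ℚ.* ε) (half-pos 0<ε))) bd

⟶-unique : ∀ {u x y} → u ⟶ x → u ⟶ y → x ≈ y
⟶-unique {u} {x} {y} (lim u⟶x _) (lim u⟶y bd) = lim (λ ε 0<ε → always λ _ →
  let (n , p , q) = witness (zipᵉ _,_ (u⟶x (½ ℚ.* ε) (half-pos 0<ε)) (u⟶y (½ ℚ.* ε) (half-pos 0<ε)))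
  in zipᵉ (λ {k} a → triangle (x k) (u n k) (y k)
       (subst (ℚ._< ½ ℚ.* ε) (abs-sym (u n k) (x k)) a)) p q) bd

⟶-pointwise : ∀ {u v x y} → (∀ n k → u n k ≡ v n k) → (∀ k → x k ≡ y k) → u ⟶ x → v ⟶ y
⟶-pointwise u≗v x≗y (lim u⟶x (B , 0<B , x≤B)) = lim
  (λ ε 0<ε → mapᵉ (λ {n} → mapᵉ λ {k} → subst₂ (λ u x → ℚ.∣ u ℚ.- x ∣ ℚ.< ε) (u≗v n k) (x≗y k)) (u⟶x ε 0<ε))
  (B , 0<B , mapᵉ (λ {k} → subst (λ x → ℚ.∣ x ∣ ℚ.≤ B) (x≗y k)) x≤B)

⟶-suc : ∀ {u x} → (λ n → u (suc n)) ⟶ x → u ⟶ x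
⟶-suc (lim u⟶x bd) = lim (λ ε 0<ε → let (N , f) = u⟶x ε 0<ε in suc N , λ { (suc n) (ℕ.s≤s N≤n) → f n N≤n }) bd

-- Made for partial sums of Cauchy products. If N is a threshold for `u`, then N + N is one for `c`:
-- from there on `c n` lies between `u N` and `u n`.
squeeze : ∀ {u c x} → (∀ m n k → m ℕ.+ m ℕ.≤ n → u m k ℚ.≤ c n k) → (∀ n k → c n k ℚ.≤ u n k) →
  u ⟶ x → c ⟶ x
squeeze {u} {c} {x} below above (lim u⟶x bd) = lim (λ ε 0<ε →
  let (N , f) = u⟶x ε 0<ε
  in N ℕ.+ N , λ n 2N≤n → zipᵉ
       (λ {k} p q → near⁻¹ {c n k} {x k}
         (ℚ.≤-<-trans (above n k) (proj₁ (near-bounds {u n k} {x k} q)))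
         (ℚ.<-≤-trans (proj₂ (near-bounds {u N k} {x k} p)) (ℚ.+-monoˡ-≤ ε (below N n k 2N≤n))))
       (f N ℕ.≤-refl) (f n (ℕ.≤-trans (ℕ.m≤m+n N N) 2N≤n))) bd

⟶-tail : ∀ {u x} → u ⟶ x → (λ n → u (suc n)) ⟶ x
⟶-tail (lim u⟶x bd) = lim (λ ε 0<ε →
  let (N , f) = u⟶x ε 0<ε in N , λ n N≤n → f (suc n) (ℕ.m≤n⇒m≤1+n N≤n)) bd

⟶-unit : ∀ {u x} → Bounded x → (∀ n → Close (unit n) (u n) x) → u ⟶ x
⟶-unit bd close = lim (λ ε 0<ε →
  let (N , small) = archimedean 0<ε
  in N , λ n N≤n → mapᵉ (λ lt → ℚ.<-≤-trans lt (small n N≤n)) (close n)) bd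

NonNeg-pointwise : ∀ {x y} → (∀ k → x k ≡ y k) → NonNeg x → NonNeg y
NonNeg-pointwise eq (nonNeg 0≤x) = nonNeg λ ε 0<ε →
  mapᵉ (λ {k} → subst (λ z → 0ℚ ℚ.< z ℚ.+ ε) (eq k)) (0≤x ε 0<ε)

NonNeg-resp : ∀ {x y} → x ≈ y → NonNeg x → NonNeg y
NonNeg-resp x≈y 0≤x = ⟶-nonNeg (λ _ → 0≤x) x≈y

≃⇒≈ : ∀ x y → x ≃ y → seq x ≈ seq y
≃⇒≈ x y (x≤y , y≤x) = lim (λ ε 0<ε → always λ _ →
  zipᵉ (λ {k} → near⁻¹ {seq x k} {seq y k}) (x≤y ε 0<ε) (y≤x ε 0<ε)) (bounded y)

-- Gives a nonnegative real a representative whose rational approximations are all nonnegative.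
∣∣≈ : ∀ {x} → Bounded x → NonNeg x → (λ k → ℚ.∣ x k ∣) ≈ x
∣∣≈ {x} bd (nonNeg 0≤x) = lim
  (λ ε 0<ε → always λ _ → mapᵉ (λ {k} → bound ε 0<ε (x k)) (0≤x (½ ℚ.* ε) (half-pos 0<ε))) bd
  where
  bound : ∀ ε → 0ℚ ℚ.< ε → ∀ q → 0ℚ ℚ.< q ℚ.+ ½ ℚ.* ε → ℚ.∣ ℚ.∣ q ∣ ℚ.- q ∣ ℚ.< ε
  bound ε 0<ε q lt with ℚ.≤-total 0ℚ q
  ... | inj₁ 0≤q = subst (ℚ._< ε)
      (cong ℚ.∣_∣ (sym (trans (cong (ℚ._- q) (ℚ.0≤p⇒∣p∣≡p 0≤q)) (ℚ.+-inverseʳ q)))) 0<ε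
  -- Here |q| = -q, and doubling -ε/2 < q gives -q < q + ε.
  ... | inj₂ q≤0 = near⁻¹ {ℚ.∣ q ∣} {q}
      (subst₂ ℚ._<_ (trans (ℚ.+-identityˡ _) (sym abs))
        (solve 2 (λ q e → (q :+ con ½ :* e) :+ (q :+ con ½ :* e) :- q := q :+ e) refl q ε)
        (ℚ.+-monoˡ-< (ℚ.- q) (Rational.+-pos lt lt)))
      (ℚ.≤-<-trans (≤abs q) (<+ ℚ.∣ q ∣ 0<ε))
    where
    abs : ℚ.∣ q ∣ ≡ ℚ.- q
    abs = trans (sym (ℚ.∣-p∣≡∣p∣ q)) (ℚ.0≤p⇒∣p∣≡p (ℚ.neg-antimono-≤ q≤0))

-- Both factors may be replaced by their absolute values, whose product is nonnegative at every
-- index.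
*-nonNeg : ∀ {x y} → Bounded x → Bounded y → NonNeg x → NonNeg y → NonNeg (λ k → x k ℚ.* y k)
*-nonNeg {x} {y} bx by 0≤x 0≤y = NonNeg-resp (⟶-* {x = x} {y} (∣∣≈ bx 0≤x) (∣∣≈ by 0≤y))
  (nonNeg-pointwise {λ k → ℚ.∣ x k ∣ ℚ.* ℚ.∣ y k ∣} λ k →
    *-nonneg {ℚ.∣ x k ∣} {ℚ.∣ y k ∣} (ℚ.0≤∣p∣ (x k)) (ℚ.0≤∣p∣ (y k)))

square-nonNeg : ∀ (x : ℕ → ℚ) → NonNeg (λ k → x k ℚ.* x k)
square-nonNeg x = nonNeg-pointwise {λ k → x k ℚ.* x k} λ k → sq (x k)
  where
  sq : ∀ q → 0ℚ ℚ.≤ q ℚ.* q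
  sq q with ℚ.≤-total 0ℚ q
  ... | inj₁ 0≤q = *-nonneg {q} {q} 0≤q 0≤q
  ... | inj₂ q≤0 = subst (0ℚ ℚ.≤_) (solve 1 (λ q → (:- q) :* (:- q) := q :* q) refl q)
                     (*-nonneg {ℚ.- q} {ℚ.- q} (ℚ.neg-antimono-≤ q≤0) (ℚ.neg-antimono-≤ q≤0))

-- The inequality from the sign of the discriminant

discriminantAt : ℚ → ℚ → ℚ
discriminantAt t p =
  ι 1 ℚ.- ι 4 ℚ.* p ℚ.+ ι 4 ℚ.* (p ℚ.* p) ℚ.- ι 8 ℚ.* (p ℚ.* p) ℚ.* t
      ℚ.+ ι 4 ℚ.* (p ℚ.* p) ℚ.* (t ℚ.* t) ℚ.- ι 4 ℚ.* p ℚ.* t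

-- Bracketed as two successive multiplications by `t`, which is what applying `sumsTo-shift` twice
-- produces.
t²disc : ℚ → ℚ → ℚ
t²disc t p = t ℚ.* (t ℚ.* discriminantAt t p)

källén : ℚ → ℚ → ℚ
källén a b = (a ℚ.- b) ℚ.* (a ℚ.- b) ℚ.- ι 2 ℚ.* (a ℚ.+ b) ℚ.+ 1ℚ

discriminant-källén : ∀ t p →
  t²disc t p ≡ t ℚ.* t ℚ.* källén (ι 2 ℚ.* p) (ι 2 ℚ.* t ℚ.* p)
discriminant-källén = solve 2 (λ t p →
  t :* (t :* (con (ι 1) :- con (ι 4) :* p :+ con (ι 4) :* (p :* p) :- con (ι 8) :* (p :* p) :* t
              :+ con (ι 4) :* (p :* p) :* (t :* t) :- con (ι 4) :* p :* t)) :=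
  let a = con (ι 2) :* p ; b = con (ι 2) :* t :* p in
  t :* t :* ((a :- b) :* (a :- b) :- con (ι 2) :* (a :+ b) :+ con 1ℚ)) refl

-- Källén's function of s² and r² factors as (s - r - 1)(1 + s - r)(s + r - 1)(1 + s + r). The first
-- factor appears here with its sign reversed, so that all four are positive when |s - r| < 1 < s +
-- r.
källén-squares : ∀ s r t →
  t ℚ.* t ℚ.* (((1ℚ ℚ.+ r ℚ.- s) ℚ.* (1ℚ ℚ.+ (s ℚ.- r))) ℚ.* ((s ℚ.- 1ℚ ℚ.+ r) ℚ.* (1ℚ ℚ.+ (s ℚ.+ r))))
    ℚ.+ t ℚ.* t ℚ.* källén (s ℚ.* s) (r ℚ.* r) ≡ 0ℚ
källén-squares = solve 3 (λ s r t →
  let a = s :* s ; b = r :* r in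
  t :* t :* (((con 1ℚ :+ r :- s) :* (con 1ℚ :+ (s :- r))) :* ((s :- con 1ℚ :+ r) :* (con 1ℚ :+ (s :+ r))))
    :+ t :* t :* ((a :- b) :* (a :- b) :- con (ι 2) :* (a :+ b) :+ con 1ℚ) := con 0ℚ) refl

källén-cong : ∀ {a b c d} → a ≈ c → b ≈ d → (λ k → källén (a k) (b k)) ≈ (λ k → källén (c k) (d k))
källén-cong a≈c b≈d = ⟶-+ (⟶-- (⟶-* (⟶-- a≈c b≈d) (⟶-- a≈c b≈d))
  (⟶-* (⟶-const (ι 2)) (⟶-+ a≈c b≈d))) (⟶-const 1ℚ)

1-pos : Pos (λ _ → 1ℚ)
1-pos = pos (½ , ℚ.positive⁻¹ ½ , always λ _ → half< {1ℚ} (ℚ.positive⁻¹ 1ℚ))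

-- Equalities of reals hold only in the limit; as weak inequalities they can enter sums that vanish
-- identically.
≈⇒NonNeg : ∀ {x y} → x ≈ y → NonNeg (λ k → y k ℚ.- x k)
≈⇒NonNeg {x} {y} x≈y = NonNeg-resp (≈-sym (⟶-- (⟶-refl (limit-bounded x≈y)) x≈y))
  (nonNeg-pointwise λ k → ℚ.≤-reflexive (sym (ℚ.+-inverseʳ (y k))))

-- The common shape of the contradictions below: a positive and a nonnegative quantity that add up
-- to zero by a ring identity.
Pos+NonNeg≢0 : ∀ {x y} → Pos x → NonNeg y → (∀ k → x k ℚ.+ y k ≡ 0ℚ) → ⊥
Pos+NonNeg≢0 0<x 0≤y eq = ¬Pos-zero (Pos-pointwise eq (+-pos 0<x 0≤y))

2*-nonNeg : ∀ {x} → NonNeg x → NonNeg (λ k → ι 2 ℚ.* x k)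
2*-nonNeg {x} 0≤x = NonNeg-pointwise
  (λ k → solve 1 (λ x → x :+ x := con (ι 2) :* x) refl (x k))
  (+-nonNeg 0≤x 0≤x)

-- `S` and `R` stand for √(2P(t)) and √(2tP(t)); only their signs and squares enter.
module _ (T P S R : ℝ) where
  private
    t p s r : ℕ → ℚ
    t = seq T
    p = seq P
    s = seq S
    r = seq R

  module _
    (0≤t : NonNeg t) (t≤1 : NonNeg (λ k → 1ℚ ℚ.- t k))
    (0≤p : NonNeg p) (1≤p : NonNeg (λ k → p k ℚ.- 1ℚ))
    (0≤s : NonNeg s) (0≤r : NonNeg r)
    (s²≈a : (λ k → s k ℚ.* s k) ≈ (λ k → ι 2 ℚ.* p k))
    (r²≈b : (λ k → r k ℚ.* r k) ≈ (λ k → ι 2 ℚ.* t k ℚ.* p k))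
    (0≤disc : NonNeg (λ k → t²disc (t k) (p k))) where

    private
      s-refl : s ≈ s
      s-refl = ⟶-refl (bounded S)
      t-refl : t ≈ t
      t-refl = ⟶-refl (bounded T)

      -- s ≤ 1 would make s² ≤ 1, but s² = 2p ≥ 2.
      s≰1 : NonNeg (λ k → 1ℚ ℚ.- s k) → ⊥
      s≰1 s≤1 = Pos+NonNeg≢0 1-pos
        (+-nonNeg (*-nonNeg (limit-bounded (⟶-- (⟶-const 1ℚ) s-refl)) (limit-bounded (⟶-+ (⟶-const 1ℚ) s-refl))
                    s≤1 (+-nonNeg (Pos⇒NonNeg 1-pos) 0≤s))
          (+-nonNeg (≈⇒NonNeg (≈-sym s²≈a)) (2*-nonNeg 1≤p)))
        λ k → solve 2 (λ s p → con 1ℚ :+ ((con 1ℚ :- s) :* (con 1ℚ :+ s) :+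
          ((s :* s :- con (ι 2) :* p) :+ con (ι 2) :* (p :- con 1ℚ))) := con 0ℚ) refl (s k) (p k)

      -- The first hypothesis negates the goal; the second may be assumed because `s≰1` refutes its
      -- opposite.
      module _ (s<1+r : Pos (λ k → 1ℚ ℚ.+ r k ℚ.- s k)) (1<s : Pos (λ k → s k ℚ.- 1ℚ)) where
        0<r : Pos r
        0<r = Pos-pointwise
          (λ k → solve 2 (λ s r → con 1ℚ :+ r :- s :+ (s :- con 1ℚ) := r) refl (s k) (r k))
          (+-pos s<1+r (Pos⇒NonNeg 1<s))

        -- t ≤ 0 would make r² = 2tp ≤ 0, although r > 0.
        t≰0 : NonNeg (λ k → 0ℚ ℚ.- t k) → ⊥
        t≰0 t≤0 = Pos+NonNeg≢0 (*-pos 0<r 0<r)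
          (+-nonNeg (≈⇒NonNeg r²≈b)
            (2*-nonNeg (*-nonNeg (limit-bounded (⟶-- (⟶-const 0ℚ) t-refl)) (bounded P) t≤0 0≤p)))
          λ k → solve 3 (λ r t p → r :* r :+ ((con (ι 2) :* t :* p :- r :* r)
            :+ con (ι 2) :* ((con 0ℚ :- t) :* p)) := con 0ℚ) refl (r k) (t k) (p k)

        -- s < r would give 2p = s² < r² = 2tp, against t ≤ 1.
        s≮r : Pos (λ k → r k ℚ.- s k) → ⊥
        s≮r s<r = Pos+NonNeg≢0 (*-pos s<r (+-pos 0<r 0≤s))
          (+-nonNeg (≈⇒NonNeg r²≈b) (+-nonNeg (≈⇒NonNeg (≈-sym s²≈a))
            (2*-nonNeg (*-nonNeg (limit-bounded (⟶-- (⟶-const 1ℚ) t-refl)) (bounded P) t≤1 0≤p))))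
          λ k → solve 4 (λ s r t p → (r :- s) :* (r :+ s) :+ ((con (ι 2) :* t :* p :- r :* r) :+
            ((s :* s :- con (ι 2) :* p) :+ con (ι 2) :* ((con 1ℚ :- t) :* p))) := con 0ℚ) refl
            (s k) (r k) (t k) (p k)

        0≤källén : NonNeg (λ k → t k ℚ.* t k ℚ.* källén (s k ℚ.* s k) (r k ℚ.* r k))
        0≤källén = NonNeg-resp (⟶-* (⟶-* t-refl t-refl) (≈-sym (källén-cong s²≈a r²≈b)))
          (NonNeg-pointwise (λ k → discriminant-källén (t k) (p k)) 0≤disc)

        -- All four factors in `källén-squares` are positive here: 1 + s - r because r ≤ s, and s -
        -- 1 + r because s > 1.
        t≯0 : NonNeg (λ k → s k ℚ.- r k) → ¬ Pos t
        t≯0 r≤s 0<t = Pos+NonNeg≢0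
          (*-pos (*-pos 0<t 0<t)
            (*-pos (*-pos s<1+r (+-pos 1-pos r≤s))
              (*-pos (+-pos 1<s 0≤r) (+-pos 1-pos (+-nonNeg 0≤s 0≤r)))))
          0≤källén λ k → källén-squares (s k) (r k) (t k)

    1+r≤s : fromℚ 1ℚ + R ≤ S
    1+r≤s = ≮⇒≥ {fromℚ 1ℚ + R} {S} λ S<1+R →
      let s<1+r = <⇒Pos {S} {fromℚ 1ℚ + R} S<1+R
      -- Only a contradiction is wanted, so each strict sign may be assumed once its opposite is
      -- refuted: first 1 < s, then 0 < t.
      in s≰1 (≯⇒NonNeg S (fromℚ 1ℚ) λ 1<s →
        t≰0 s<1+r 1<s (≯⇒NonNeg T (fromℚ 0ℚ) λ 0<t-0 →
          t≯0 s<1+r 1<s (≯⇒NonNeg R S (s≮r s<1+r 1<s))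
            (Pos-pointwise (λ k → ℚ.+-identityʳ (t k)) 0<t-0)))

1+√≤√ : ∀ t p → NonNeg (seq t) → NonNeg (λ k → 1ℚ ℚ.- seq t k) → NonNeg (λ k → seq p k ℚ.- 1ℚ) →
  NonNeg (λ k → t²disc (seq t k) (seq p k)) →
  fromℚ 1ℚ + √ (fromℚ (ι 2) * t * p) ≤ √ (fromℚ (ι 2) * p)
1+√≤√ t p 0≤t t≤1 1≤p 0≤disc =
  1+r≤s t p (√ a) (√ b) 0≤t t≤1 0≤p 1≤p (√-nonNeg a) (√-nonNeg b)
    (≃⇒≈ (√ a * √ a) a (√-square a (0≤-real a (2*-nonNeg 0≤p))))
    (≃⇒≈ (√ b * √ b) b (√-square b (0≤-real b
      (*-nonNeg (bounded (fromℚ (ι 2) * t)) (bounded p) (2*-nonNeg 0≤t) 0≤p)))) 0≤disc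
  where
  a = fromℚ (ι 2) * p
  b = fromℚ (ι 2) * t * p

  √-nonNeg : ∀ x → NonNeg (seq (√ x))
  √-nonNeg x = nonNeg (√-nonneg x)

  0≤-real : ∀ x → NonNeg (seq x) → fromℚ 0ℚ ≤ x
  0≤-real x (nonNeg 0≤x) = 0≤x

  0≤p : NonNeg (seq p)
  0≤p = NonNeg-pointwise (λ k → solve 1 (λ p → p :- con 1ℚ :+ con 1ℚ := p) refl (seq p k))
    (+-nonNeg 1≤p (Pos⇒NonNeg 1-pos))

-- Power series

Σ-cong : ∀ n {f g : Series} → (∀ i → i ℕ.< n → f i ≡ g i) → Σℚ n f ≡ Σℚ n g
Σ-cong zero    eq = refl
Σ-cong (suc n) eq = cong₂ ℚ._+_ (Σ-cong n λ i i<n → eq i (ℕ.m≤n⇒m≤1+n i<n)) (eq n ℕ.≤-refl)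

Σ-mono : ∀ n {f g : Series} → (∀ i → i ℕ.< n → f i ℚ.≤ g i) → Σℚ n f ℚ.≤ Σℚ n g
Σ-mono zero    le = ℚ.≤-refl
Σ-mono (suc n) le = ℚ.+-mono-≤ (Σ-mono n λ i i<n → le i (ℕ.m≤n⇒m≤1+n i<n)) (le n ℕ.≤-refl)

Σ-zero : ∀ n → Σℚ n (λ _ → 0ℚ) ≡ 0ℚ
Σ-zero zero    = refl
Σ-zero (suc n) = trans (ℚ.+-identityʳ (Σℚ n (λ _ → 0ℚ))) (Σ-zero n)

Σ-+ : ∀ n (f g : Series) → Σℚ n (λ i → f i ℚ.+ g i) ≡ Σℚ n f ℚ.+ Σℚ n g
Σ-+ zero    f g = refl
Σ-+ (suc n) f g = trans (cong (ℚ._+ (f n ℚ.+ g n)) (Σ-+ n f g))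
  (solve 4 (λ a b c d → (a :+ b) :+ (c :+ d) := (a :+ c) :+ (b :+ d)) refl (Σℚ n f) (Σℚ n g) (f n) (g n))

Σ-neg : ∀ n (f : Series) → Σℚ n (λ i → ℚ.- f i) ≡ ℚ.- Σℚ n f
Σ-neg zero    f = refl
Σ-neg (suc n) f = trans (cong (ℚ._- f n) (Σ-neg n f)) (sym (ℚ.neg-distrib-+ (Σℚ n f) (f n)))

Σ-- : ∀ n (f g : Series) → Σℚ n (λ i → f i ℚ.- g i) ≡ Σℚ n f ℚ.- Σℚ n g
Σ-- n f g = trans (Σ-+ n f (λ i → ℚ.- g i)) (cong (Σℚ n f ℚ.+_) (Σ-neg n g))

Σ-*ʳ : ∀ n (f : Series) c → Σℚ n (λ i → f i ℚ.* c) ≡ Σℚ n f ℚ.* c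
Σ-*ʳ zero    f c = sym (ℚ.*-zeroˡ c)
Σ-*ʳ (suc n) f c = trans (cong (ℚ._+ f n ℚ.* c) (Σ-*ʳ n f c)) (sym (ℚ.*-distribʳ-+ c (Σℚ n f) (f n)))

Σ-sucˡ : ∀ n (f : Series) → Σℚ (suc n) f ≡ f 0 ℚ.+ Σℚ n (λ i → f (suc i))
Σ-sucˡ zero    f = ℚ.+-comm 0ℚ (f 0)
Σ-sucˡ (suc n) f = trans (cong (ℚ._+ f (suc n)) (Σ-sucˡ n f))
  (ℚ.+-assoc (f 0) (Σℚ n (λ i → f (suc i))) (f (suc n)))

Σ-extend : ∀ {m n} (f : Series) → (∀ i → 0ℚ ℚ.≤ f i) → m ℕ.≤ n → Σℚ m f ℚ.≤ Σℚ n f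
Σ-extend {m} f 0≤f m≤n = go (ℕ.≤⇒≤′ m≤n)
  where
  go : ∀ {n} → m ℕ.≤′ n → Σℚ m f ℚ.≤ Σℚ n f
  go ℕ.≤′-refl = ℚ.≤-refl
  go (ℕ.≤′-step {n} m≤n) = ℚ.≤-trans (go m≤n)
    (subst (ℚ._≤ Σℚ n f ℚ.+ f n) (ℚ.+-identityʳ (Σℚ n f)) (ℚ.+-monoʳ-≤ (Σℚ n f) (0≤f n)))

Σ-nonneg : ∀ n (f : Series) → (∀ i → 0ℚ ℚ.≤ f i) → 0ℚ ℚ.≤ Σℚ n f
Σ-nonneg n f 0≤f = Σ-extend {0} {n} f 0≤f ℕ.z≤n

suc-∸ : ∀ {k n} → k ℕ.≤ n → suc n ℕ.∸ k ≡ suc (n ℕ.∸ k)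
suc-∸ = ℕ.+-∸-assoc 1

module _ (α β : Series) where

  -- Both sides sum the products `α i ℚ.* β j` over the triangle i + j < n, the left by
  -- antidiagonals and the right by rows.
  Σ-*ˢ : ∀ n → Σℚ n (α *ˢ β) ≡ Σℚ n (λ k → α k ℚ.* Σℚ (n ℕ.∸ k) β)
  Σ-*ˢ zero    = refl
  Σ-*ˢ (suc n) = trans (cong (ℚ._+ (α *ˢ β) n) (trans (Σ-*ˢ n) diagonal))
    (trans (sym (Σ-+ (suc n) (λ k → α k ℚ.* Σℚ (n ℕ.∸ k) β) (λ k → α k ℚ.* β (n ℕ.∸ k))))
      (Σ-cong (suc n) λ { k (ℕ.s≤s k≤n) → trans (sym (ℚ.*-distribˡ-+ (α k) (Σℚ (n ℕ.∸ k) β) (β (n ℕ.∸ k))))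
        (cong (λ m → α k ℚ.* Σℚ m β) (sym (suc-∸ k≤n))) }))
    where
    -- The added row k = n has length n - n = 0.
    diagonal : Σℚ n (λ k → α k ℚ.* Σℚ (n ℕ.∸ k) β) ≡ Σℚ (suc n) (λ k → α k ℚ.* Σℚ (n ℕ.∸ k) β)
    diagonal = sym (trans (cong (λ m → Σℚ n (λ k → α k ℚ.* Σℚ (n ℕ.∸ k) β) ℚ.+ α n ℚ.* Σℚ m β) (ℕ.n∸n≡0 n))
      (trans (cong (Σℚ n (λ k → α k ℚ.* Σℚ (n ℕ.∸ k) β) ℚ.+_) (ℚ.*-zeroʳ (α n))) (ℚ.+-identityʳ _)))

  module _ (0≤α : ∀ i → 0ℚ ℚ.≤ α i) (0≤β : ∀ i → 0ℚ ℚ.≤ β i) where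

    -- The triangle i + j < n lies in the square i, j < n.
    *ˢ-upper : ∀ n → Σℚ n (α *ˢ β) ℚ.≤ Σℚ n α ℚ.* Σℚ n β
    *ˢ-upper n = subst₂ ℚ._≤_ (sym (Σ-*ˢ n)) (Σ-*ʳ n α (Σℚ n β)) (Σ-mono n λ k _ →
      ℚ.*-monoˡ-≤-nonNeg (α k) {{ℚ.nonNegative (0≤α k)}} (Σ-extend β 0≤β (ℕ.m∸n≤m n k)))

    -- The square i, j < m lies in the triangle i + j < n as soon as 2m ≤ n.
    *ˢ-lower : ∀ m n → m ℕ.+ m ℕ.≤ n → Σℚ m α ℚ.* Σℚ m β ℚ.≤ Σℚ n (α *ˢ β)
    *ˢ-lower m n 2m≤n = subst₂ ℚ._≤_ (Σ-*ʳ m α (Σℚ m β)) (sym (Σ-*ˢ n))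
      (ℚ.≤-trans
        (Σ-mono m λ k k<m → ℚ.*-monoˡ-≤-nonNeg (α k) {{ℚ.nonNegative (0≤α k)}}
          (Σ-extend β 0≤β (ℕ.m+n≤o⇒m≤o∸n m (ℕ.≤-trans (ℕ.+-monoʳ-≤ m (ℕ.<⇒≤ k<m)) 2m≤n))))
        (Σ-extend (λ k → α k ℚ.* Σℚ (n ℕ.∸ k) β) (λ k → *-nonneg (0≤α k) (Σ-nonneg (n ℕ.∸ k) β 0≤β))
          (ℕ.≤-trans (ℕ.m≤m+n m m) 2m≤n)))

-- Multiplication by the variable, in a form free of Cauchy products.
shift : Series → Series
shift a zero    = 0ℚ
shift a (suc n) = a n

shift-cong : ∀ {a b} → a ≗ b → shift a ≗ shift b
shift-cong a≗b zero    = refl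
shift-cong a≗b (suc n) = a≗b n

*ˢ-cong : ∀ {a b c d} → a ≗ c → b ≗ d → a *ˢ b ≗ c *ˢ d
*ˢ-cong a≗c b≗d n = Σ-cong (suc n) λ k _ → cong₂ ℚ._*_ (a≗c k) (b≗d (n ℕ.∸ k))

shift-*ˡ : ∀ a b → shift a *ˢ b ≗ shift (a *ˢ b)
shift-*ˡ a b zero    = trans (ℚ.+-identityˡ _) (ℚ.*-zeroˡ (b 0))
shift-*ˡ a b (suc n) = trans (Σ-sucˡ (suc n) (λ k → shift a k ℚ.* b (suc n ℕ.∸ k)))
  (trans (cong (ℚ._+ (a *ˢ b) n) (ℚ.*-zeroˡ (b (suc n)))) (ℚ.+-identityˡ ((a *ˢ b) n)))

shift-*ʳ : ∀ a b → a *ˢ shift b ≗ shift (a *ˢ b)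
shift-*ʳ a b zero    = trans (ℚ.+-identityˡ _) (ℚ.*-zeroʳ (a 0))
shift-*ʳ a b (suc n) = trans (cong₂ ℚ._+_
    (Σ-cong (suc n) λ { k (ℕ.s≤s k≤n) → cong (λ m → a k ℚ.* shift b m) (suc-∸ k≤n) })
    (trans (cong (λ m → a (suc n) ℚ.* shift b m) (ℕ.n∸n≡0 n)) (ℚ.*-zeroʳ (a (suc n)))))
  (ℚ.+-identityʳ ((a *ˢ b) n))

const1-*ˢ : ∀ a → const 1 *ˢ a ≗ a
const1-*ˢ a n = trans (Σ-sucˡ n (λ k → const 1 k ℚ.* a (n ℕ.∸ k)))
  (trans (cong₂ ℚ._+_ (ℚ.*-identityˡ (a n))
    (trans (Σ-cong n λ k _ → ℚ.*-zeroˡ (a (n ℕ.∸ suc k))) (Σ-zero n))) (ℚ.+-identityʳ (a n)))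

var≗shift : var ≗ shift (const 1)
var≗shift zero          = refl
var≗shift (suc zero)    = refl
var≗shift (suc (suc n)) = refl

var-*ˢ : ∀ a → var *ˢ a ≗ shift a
var-*ˢ a n = trans (*ˢ-cong {b = a} var≗shift (λ _ → refl) n)
  (trans (shift-*ˡ (const 1) a n) (shift-cong (const1-*ˢ a) n))

-ˢ-square : ∀ a b → (a -ˢ b) ² ≗ a *ˢ a -ˢ a *ˢ b -ˢ b *ˢ a +ˢ b *ˢ b
-ˢ-square a b n = trans
  (Σ-cong (suc n) λ k _ → solve 4 (λ a b c d → (a :- b) :* (c :- d) := a :* c :- a :* d :- b :* c :+ b :* d)
    refl (a k) (b k) (a (n ℕ.∸ k)) (b (n ℕ.∸ k)))
  (trans (Σ-+ (suc n) (λ k → f k ℚ.- g k ℚ.- h k) l) (cong (ℚ._+ Σℚ (suc n) l)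
    (trans (Σ-- (suc n) (λ k → f k ℚ.- g k) h) (cong (ℚ._- Σℚ (suc n) h) (Σ-- (suc n) f g)))))
  where
  f g h l : Series
  f k = a k ℚ.* a (n ℕ.∸ k)
  g k = a k ℚ.* b (n ℕ.∸ k)
  h k = b k ℚ.* a (n ℕ.∸ k)
  l k = b k ℚ.* b (n ℕ.∸ k)

-- Summation of power series at a real point.

module Sums (t : ℝ) where

  term : Series → ℕ → Series
  term a k i = a i ℚ.* seq (t ^ i) k

  record _sumsTo_ (a : Series) (y : ℕ → ℚ) : Set where
    constructor sums
    field partialSums⟶ : (λ n k → Σℚ n (term a k)) ⟶ y
  open _sumsTo_ public

  partialSum≡Σ : ∀ a n k → seq (partialSum a t n) k ≡ Σℚ n (term a k)
  partialSum≡Σ a zero    k = refl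
  partialSum≡Σ a (suc n) k = cong (ℚ._+ term a k n) (partialSum≡Σ a n k)

  HasSum⇒sumsTo : ∀ {a y} → HasSum a t y → a sumsTo seq y
  HasSum⇒sumsTo {a} {y} s = sums (⟶-pointwise (partialSum≡Σ a) (λ _ → refl)
    (lim (λ ε 0<ε → mapᵉ (λ {n} → strictly-close (partialSum a t n) y {ε}) (s ε 0<ε)) (bounded y)))

  sumsTo-cong : ∀ {a b y} → a ≗ b → a sumsTo y → b sumsTo y
  sumsTo-cong a≗b (sums p) = sums (⟶-pointwise
    (λ n k → Σ-cong n λ i _ → cong (ℚ._* seq (t ^ i) k) (a≗b i)) (λ _ → refl) p)

  infixl 6 _⊕_ _⊖_

  _⊕_ : ∀ {a b y z} → a sumsTo y → b sumsTo z → (a +ˢ b) sumsTo (λ k → y k ℚ.+ z k)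
  _⊕_ {a} {b} (sums p) (sums q) = sums (⟶-pointwise (λ n k → trans (sym (Σ-+ n (term a k) (term b k)))
    (Σ-cong n λ i _ → sym (ℚ.*-distribʳ-+ (seq (t ^ i) k) (a i) (b i)))) (λ _ → refl) (⟶-+ p q))

  _⊖_ : ∀ {a b y z} → a sumsTo y → b sumsTo z → (a -ˢ b) sumsTo (λ k → y k ℚ.- z k)
  _⊖_ {a} {b} (sums p) (sums q) = sums (⟶-pointwise (λ n k → trans (sym (Σ-- n (term a k) (term b k)))
    (Σ-cong n λ i _ → solve 3 (λ a b x → a :* x :- b :* x := (a :- b) :* x) refl (a i) (b i) (seq (t ^ i) k)))
    (λ _ → refl) (⟶-- p q))

  -- The partial sum of length n + 1 of the shifted series is t times that of length n of the
  -- original, its leading term being zero.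
  sumsTo-shift : ∀ {a y} → a sumsTo y → shift a sumsTo (λ k → seq t k ℚ.* y k)
  sumsTo-shift {a} (sums p) = sums (⟶-suc (⟶-pointwise
    (λ n k → sym (trans (Σ-sucˡ n (term (shift a) k)) (trans
      (cong₂ ℚ._+_ (ℚ.*-zeroˡ (seq (t ^ 0) k))
        (trans (Σ-cong n λ i _ → solve 3 (λ a x y → a :* (x :* y) := a :* y :* x) refl
            (a i) (seq t k) (seq (t ^ i) k))
          (Σ-*ʳ n (term a k) (seq t k))))
      (trans (ℚ.+-identityˡ _) (ℚ.*-comm _ (seq t k))))))
    (λ _ → refl) (⟶-* (⟶-refl (bounded t)) p)))

  sumsTo-const : ∀ c → const c sumsTo (λ _ → ι c)
  sumsTo-const c = sums (⟶-suc (⟶-pointwise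
    (λ n k → sym (trans (Σ-sucˡ n (term (const c) k)) (trans
      (cong₂ ℚ._+_ (ℚ.*-identityʳ (ι c)) (trans (Σ-cong n λ i _ → ℚ.*-zeroˡ (seq (t ^ suc i) k)) (Σ-zero n)))
      (ℚ.+-identityʳ (ι c)))))
    (λ _ → refl) (⟶-const (ι c))))

  sumsTo-var : var sumsTo seq t
  sumsTo-var = sums (⟶-pointwise (λ _ _ → refl) (λ k → ℚ.*-identityʳ (seq t k))
    (partialSums⟶ (sumsTo-cong (λ n → sym (var≗shift n)) (sumsTo-shift (sumsTo-const 1)))))

  -- Nonnegativity is required of every rational approximation of `t`, so that the comparisons of
  -- triangles with squares apply at each index `k`.
  module Products (0≤t : ∀ k → 0ℚ ℚ.≤ seq t k) where

    power-nonneg : ∀ n k → 0ℚ ℚ.≤ seq (t ^ n) k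
    power-nonneg zero    k = ℚ.nonNegative⁻¹ 1ℚ
    power-nonneg (suc n) k = *-nonneg (0≤t k) (power-nonneg n k)

    power-+ : ∀ m n k → seq (t ^ (m ℕ.+ n)) k ≡ seq (t ^ m) k ℚ.* seq (t ^ n) k
    power-+ zero    n k = sym (ℚ.*-identityˡ (seq (t ^ n) k))
    power-+ (suc m) n k = trans (cong (seq t k ℚ.*_) (power-+ m n k))
      (sym (ℚ.*-assoc (seq t k) (seq (t ^ m) k) (seq (t ^ n) k)))

    -- Since t^n = t^i t^(n-i), evaluating a Cauchy product gives the Cauchy product of the
    -- evaluated terms; this reduces `_⊗⁺_` to numerical series.
    term-*ˢ : ∀ a b k n → term (a *ˢ b) k n ≡ (term a k *ˢ term b k) n
    term-*ˢ a b k n = trans (sym (Σ-*ʳ (suc n) (λ i → a i ℚ.* b (n ℕ.∸ i)) (seq (t ^ n) k)))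
      (Σ-cong (suc n) λ { i (ℕ.s≤s i≤n) → trans
        (cong (a i ℚ.* b (n ℕ.∸ i) ℚ.*_)
          (trans (cong (λ m → seq (t ^ m) k) (sym (ℕ.m+[n∸m]≡n i≤n))) (power-+ i (n ℕ.∸ i) k)))
        (solve 4 (λ a b x y → a :* b :* (x :* y) := a :* x :* (b :* y)) refl
          (a i) (b (n ℕ.∸ i)) (seq (t ^ i) k) (seq (t ^ (n ℕ.∸ i)) k)) })

    record _sums⁺To_ (a : Series) (y : ℕ → ℚ) : Set where
      constructor _,⁺_
      field
        coefficients-nonneg : ∀ n → 0ℚ ℚ.≤ a n
        summation           : a sumsTo y
    open _sums⁺To_ public

    infixl 6 _⊕⁺_
    infixl 7 _⊗⁺_

    _⊕⁺_ : ∀ {a b y z} → a sums⁺To y → b sums⁺To z → (a +ˢ b) sums⁺To (λ k → y k ℚ.+ z k)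
    _⊕⁺_ {a} {b} (0≤a ,⁺ p) (0≤b ,⁺ q) =
      (λ n → Rational.+-nonneg (0≤a n) (0≤b n)) ,⁺ (p ⊕ q)

    _⊗⁺_ : ∀ {a b y z} → a sums⁺To y → b sums⁺To z → (a *ˢ b) sums⁺To (λ k → y k ℚ.* z k)
    _⊗⁺_ {a} {b} (0≤a ,⁺ sums p) (0≤b ,⁺ sums q) =
      (λ n → Σ-nonneg-upto n) ,⁺
      sums (⟶-pointwise (λ n k → sym (Σ-cong n λ i _ → term-*ˢ a b k i)) (λ _ → refl)
        (squeeze
          (λ m n k → *ˢ-lower (term a k) (term b k) (0≤term 0≤a k) (0≤term 0≤b k) m n)
          (λ n k → *ˢ-upper (term a k) (term b k) (0≤term 0≤a k) (0≤term 0≤b k) n)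
          (⟶-* p q)))
      where
      0≤term : ∀ {a} → (∀ n → 0ℚ ℚ.≤ a n) → ∀ k i → 0ℚ ℚ.≤ term a k i
      0≤term 0≤a k i = *-nonneg (0≤a i) (power-nonneg i k)

      Σ-nonneg-upto : ∀ n → 0ℚ ℚ.≤ (a *ˢ b) n
      Σ-nonneg-upto n = Σ-nonneg (suc n) (λ k → a k ℚ.* b (n ℕ.∸ k)) λ k → *-nonneg (0≤a k) (0≤b (n ℕ.∸ k))

    const⁺ : ∀ c → const c sums⁺To (λ _ → ι c)
    const⁺ c = nonneg ,⁺ sumsTo-const c
      where
      nonneg : ∀ n → 0ℚ ℚ.≤ const c n
      nonneg zero    = Rational.ι-≤ 0 c ℕ.z≤n
      nonneg (suc n) = ℚ.≤-refl

    var⁺ : var sums⁺To seq t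
    var⁺ = nonneg ,⁺ sumsTo-var
      where
      nonneg : ∀ n → 0ℚ ℚ.≤ var n
      nonneg zero          = ℚ.≤-refl
      nonneg (suc zero)    = ℚ.nonNegative⁻¹ 1ℚ
      nonneg (suc (suc n)) = ℚ.≤-refl

-- The deque equation

module DequeSeries (P D : Series) where

  discriminantOf : Series
  discriminantOf =
    const 1 -ˢ const 4 *ˢ P +ˢ const 4 *ˢ P ² -ˢ const 8 *ˢ P ² *ˢ var
            +ˢ const 4 *ˢ P ² *ˢ var ² -ˢ const 4 *ˢ P *ˢ var

  module _ (S : Series) (S²≗disc : S ² ≗ discriminantOf)
    (equation : const 2 *ˢ D ≗
      const 2 +ˢ var +ˢ const 2 *ˢ P *ˢ var -ˢ const 2 *ˢ P *ˢ var ² -ˢ var *ˢ S) where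

    -- t times the square root is V₁ - V₂, where V₁ and V₂ have nonnegative coefficients: for such
    -- series the partial sums of a Cauchy product are squeezed by products of partial sums.
    V₁ V₂ : Series
    V₁ = const 2 +ˢ var +ˢ const 2 *ˢ P *ˢ var
    V₂ = const 2 *ˢ P *ˢ var ² +ˢ const 2 *ˢ D

    var*S≗difference : var *ˢ S ≗ V₁ -ˢ V₂
    var*S≗difference n = trans
      (solve 3 (λ v w x → x := v :- (w :+ (v :- w :- x))) refl
        (V₁ n) ((const 2 *ˢ P *ˢ var ²) n) ((var *ˢ S) n))
      (cong (λ z → V₁ n ℚ.- ((const 2 *ˢ P *ˢ var ²) n ℚ.+ z)) (sym (equation n)))

    -- Both factors equal t S, so the shifts can be pulled out of the product, leaving S².
    difference-square : (V₁ -ˢ V₂) ² ≗ shift (shift discriminantOf)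
    difference-square n =
      trans (*ˢ-cong shift≗ shift≗ n)
      (trans (shift-*ˡ S (shift S) n)
      (shift-cong (λ m → trans (shift-*ʳ S S m) (shift-cong S²≗disc m)) n))
      where
      shift≗ : V₁ -ˢ V₂ ≗ shift S
      shift≗ m = trans (sym (var*S≗difference m)) (var-*ˢ S m)

    module _ (t : ℝ) (0≤t : ∀ k → 0ℚ ℚ.≤ seq t k) where
      open Sums t
      open Products 0≤t

      -- The series of t² times the radicand is summed twice, once as the square of `V₁ -ˢ V₂` and
      -- once term by term; uniqueness of limits identifies the second value with a square.
      t²disc-nonNeg : ∀ {p d} → P sums⁺To p → D sums⁺To d →
        NonNeg (λ k → t²disc (seq t k) (p k))
      t²disc-nonNeg {p} {d} P⁺ D⁺ = NonNeg-resp (⟶-unique (partialSums⟶ square-sum) (partialSums⟶ disc-sum))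
        (NonNeg-pointwise (λ k → solve 2 (λ x y → (x :- y) :* (x :- y) := x :* x :- x :* y :- y :* x :+ y :* y)
            refl (v₁ k) (v₂ k)) (square-nonNeg (λ k → v₁ k ℚ.- v₂ k)))
        where
        v₁ v₂ : ℕ → ℚ
        v₁ k = ι 2 ℚ.+ seq t k ℚ.+ ι 2 ℚ.* p k ℚ.* seq t k
        v₂ k = ι 2 ℚ.* p k ℚ.* (seq t k ℚ.* seq t k) ℚ.+ ι 2 ℚ.* d k

        V₁⁺ : V₁ sums⁺To v₁
        V₁⁺ = const⁺ 2 ⊕⁺ var⁺ ⊕⁺ const⁺ 2 ⊗⁺ P⁺ ⊗⁺ var⁺

        V₂⁺ : V₂ sums⁺To v₂
        V₂⁺ = const⁺ 2 ⊗⁺ P⁺ ⊗⁺ (var⁺ ⊗⁺ var⁺) ⊕⁺ const⁺ 2 ⊗⁺ D⁺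

        square-sum : shift (shift discriminantOf) sumsTo
          (λ k → v₁ k ℚ.* v₁ k ℚ.- v₁ k ℚ.* v₂ k ℚ.- v₂ k ℚ.* v₁ k ℚ.+ v₂ k ℚ.* v₂ k)
        square-sum = sumsTo-cong
          (λ n → trans (sym (-ˢ-square V₁ V₂ n)) (difference-square n))
          (summation (V₁⁺ ⊗⁺ V₁⁺) ⊖ summation (V₁⁺ ⊗⁺ V₂⁺) ⊖ summation (V₂⁺ ⊗⁺ V₁⁺) ⊕ summation (V₂⁺ ⊗⁺ V₂⁺))

        disc-sum : shift (shift discriminantOf) sumsTo
          (λ k → t²disc (seq t k) (p k))
        disc-sum = sumsTo-shift (sumsTo-shift
          (sumsTo-const 1 ⊖ summation (const⁺ 4 ⊗⁺ P⁺) ⊕ summation (const⁺ 4 ⊗⁺ (P⁺ ⊗⁺ P⁺))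
            ⊖ summation (const⁺ 8 ⊗⁺ (P⁺ ⊗⁺ P⁺) ⊗⁺ var⁺)
            ⊕ summation (const⁺ 4 ⊗⁺ (P⁺ ⊗⁺ P⁺) ⊗⁺ (var⁺ ⊗⁺ var⁺))
            ⊖ summation (const⁺ 4 ⊗⁺ P⁺ ⊗⁺ var⁺)))

-- Below and at the radius of convergence

power-cong : ∀ {s t} → seq s ≈ seq t → ∀ n → seq (s ^ n) ≈ seq (t ^ n)
power-cong s≈t zero    = ⟶-const 1ℚ
power-cong s≈t (suc n) = ⟶-* s≈t (power-cong s≈t n)

sumsTo-resp : ∀ {s t} → seq s ≈ seq t → ∀ {a y} → Sums._sumsTo_ t a y → Sums._sumsTo_ s a y
sumsTo-resp {s} {t} s≈t {a} p = Sums.sums (⟶-respˡ terms≈ (Sums.partialSums⟶ p))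
  where
  terms≈ : ∀ n → (λ k → Σℚ n (Sums.term s a k)) ≈ (λ k → Σℚ n (Sums.term t a k))
  terms≈ zero    = ⟶-const 0ℚ
  terms≈ (suc n) = ⟶-+ (terms≈ n) (⟶-* (⟶-const (a n)) (power-cong {s} {t} s≈t n))

⟶-t²disc : ∀ {u v t p} → u ⟶ t → v ⟶ p →
  (λ n k → t²disc (u n k) (v n k)) ⟶ (λ k → t²disc (t k) (p k))
⟶-t²disc t p = ⟶-* t (⟶-* t
  (⟶-- (⟶-+ (⟶-- (⟶-+ (⟶-- (⟶-const (ι 1)) (⟶-* (⟶-const (ι 4)) p))
                        (⟶-* (⟶-const (ι 4)) (⟶-* p p)))
                  (⟶-* (⟶-* (⟶-const (ι 8)) (⟶-* p p)) t))
            (⟶-* (⟶-* (⟶-const (ι 4)) (⟶-* p p)) (⟶-* t t)))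
       (⟶-* (⟶-* (⟶-const (ι 4)) p) t)))

-- The constant term alone contributes 1 and all other terms are nonnegative.
1≤sum : ∀ t → (∀ k → 0ℚ ℚ.≤ seq t k) → ∀ {a y} → a 0 ≡ 1ℚ → (∀ n → 0ℚ ℚ.≤ a n) →
  Sums._sumsTo_ t a y → NonNeg (λ k → y k ℚ.- 1ℚ)
1≤sum t 0≤t {a} a₀≡1 0≤a p = ⟶-nonNeg
  (λ n → nonNeg-pointwise λ k → subst (ℚ._≤ Σℚ (suc n) (term a k) ℚ.- 1ℚ) (ℚ.+-inverseʳ 1ℚ)
    (ℚ.+-monoˡ-≤ (ℚ.- 1ℚ) (subst (ℚ._≤ Σℚ (suc n) (term a k)) (first k)
      (Σ-extend (term a k) (λ i → *-nonneg (0≤a i) (power-nonneg i k)) (ℕ.s≤s (ℕ.z≤n {n}))))))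
  -- The empty partial sum is 0, so the bound holds only from length 1 on.
  (⟶-- (⟶-tail (partialSums⟶ p)) (⟶-const 1ℚ))
  where
  open Sums t
  open Products 0≤t
  first : ∀ k → 0ℚ ℚ.+ term a k 0 ≡ 1ℚ
  first k = cong (λ z → 0ℚ ℚ.+ z ℚ.* 1ℚ) a₀≡1

∣∣-< : ∀ t c → NonNeg (seq t) → t < c → ∣ t ∣ < c
∣∣-< t c 0≤t (ε , 0<ε , ev) = ½ ℚ.* ε , half-pos 0<ε , zipᵉ
  (λ {k} lt close → ℚ.<-trans
    (subst (ℚ.∣ seq t k ∣ ℚ.+ ½ ℚ.* ε ℚ.<_)
      (trans (ℚ.+-assoc (seq t k) (½ ℚ.* ε) (½ ℚ.* ε)) (cong (seq t k ℚ.+_) (halve ε)))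
      (ℚ.+-monoˡ-< (½ ℚ.* ε) (near {ℚ.∣ seq t k ∣} {seq t k} close)))
    lt)
  ev (proj₂ (witness (eventually-close (∣∣≈ (bounded t) 0≤t) (½ ℚ.* ε) (half-pos 0<ε))))

P-nonneg : ∀ n → 0ℚ ℚ.≤ P n
P-nonneg n = Rational.ι-≤ 0 (numParallel n) ℕ.z≤n

D-nonneg : ∀ n → 0ℚ ℚ.≤ D n
D-nonneg n = Rational.ι-≤ 0 (numDeque n) ℕ.z≤n

module _ (deque-equation : DequeEquation) (tc : ℝ) (radius-P : RadiusOfConvergence P tc)
         (radius-D : RadiusOfConvergence D tc) (tc<1 : tc < fromℚ 1ℚ) where

  module BelowRadius (t Pt : ℝ) (0≤t : NonNeg (seq t)) (t<tc : t < tc) (Pt-sum : HasSum P t Pt) where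
    private
      -- Unlike those of t, the rational approximations of ∣ t ∣ are nonnegative.
      ∣t∣≈t : seq ∣ t ∣ ≈ seq t
      ∣t∣≈t = ∣∣≈ (bounded t) 0≤t

      0≤∣t∣ : ∀ k → 0ℚ ℚ.≤ seq ∣ t ∣ k
      0≤∣t∣ k = ℚ.0≤∣p∣ (seq t k)

      P-sum : Sums._sumsTo_ ∣ t ∣ P (seq Pt)
      P-sum = sumsTo-resp {∣ t ∣} {t} ∣t∣≈t (Sums.HasSum⇒sumsTo t {P} {Pt} Pt-sum)

    1≤Pt : NonNeg (λ k → seq Pt k ℚ.- 1ℚ)
    -- `refl` evaluates `P 0`: the empty permutation is the only one of length 0, and it is
    -- sortable.
    1≤Pt = 1≤sum ∣ t ∣ 0≤∣t∣ {P} refl P-nonneg P-sum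

    0≤t²disc : NonNeg (λ k → t²disc (seq t k) (seq Pt k))
    0≤t²disc =
      let (S , (_ , S²≗disc) , equation) = deque-equation
          -- Here the common radius of convergence enters: |t| < tc makes D converge at t.
          (Dt , Dt-sum) = proj₁ (proj₂ radius-D) t (∣∣-< t tc 0≤t t<tc)
          D-sum = sumsTo-resp {∣ t ∣} {t} ∣t∣≈t (Sums.HasSum⇒sumsTo t {D} {Dt} Dt-sum)
      in NonNeg-resp (⟶-t²disc ∣t∣≈t (⟶-refl (bounded Pt)))
           (DequeSeries.t²disc-nonNeg P D S S²≗disc equation ∣ t ∣ 0≤∣t∣
             (Sums.Products._,⁺_ P-nonneg P-sum) (Sums.Products._,⁺_ D-nonneg D-sum))

    t≤1 : NonNeg (λ k → 1ℚ ℚ.- seq t k)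
    t≤1 = NonNeg-pointwise
      (λ k → solve 2 (λ t c → (con 1ℚ :- c) :+ (c :- t) := con 1ℚ :- t) refl (seq t k) (seq tc k))
      (+-nonNeg (Pos⇒NonNeg (<⇒Pos {tc} {fromℚ 1ℚ} tc<1)) (Pos⇒NonNeg (<⇒Pos {t} {tc} t<tc)))

  module AtRadius (Ptc : ℝ) (limit : LeftLimit (HasSum P) tc Ptc) where

    -- If tc were 0, P would converge at negative points t with |t| > tc.
    tc≰0 : ¬ NonNeg (λ k → 0ℚ ℚ.- seq tc k)
    tc≰0 tc≤0 =
      let (t , y , _ , t<tc , sum) = proj₁ limit 1ℚ (ℚ.positive⁻¹ 1ℚ)
      in proj₂ (proj₂ radius-P) t
        (Pos⇒< tc ∣ t ∣ (Pos-pointwise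
          (λ k → solve 3 (λ t c a → (c :- t) :+ ((con 0ℚ :- c) :+ ((con 0ℚ :- c) :+ (a :+ t))) := a :- c) refl
             (seq t k) (seq tc k) ℚ.∣ seq t k ∣)
          (+-pos (<⇒Pos {t} {tc} t<tc) (+-nonNeg tc≤0 (+-nonNeg tc≤0
            (nonNeg-pointwise λ k → 0≤∣q∣+q (seq t k)))))))
        (y , sum)
      where
      0≤∣q∣+q : ∀ q → 0ℚ ℚ.≤ ℚ.∣ q ∣ ℚ.+ q
      0≤∣q∣+q q = subst₂ ℚ._≤_ (ℚ.+-inverseˡ q) (cong (ℚ._+ q) (ℚ.∣-p∣≡∣p∣ q))
        (ℚ.+-monoˡ-≤ q (≤abs (ℚ.- q)))

    module _ (0<tc : Pos (seq tc)) where
      -- Puts the left limit into sequential form, to which the limit laws apply.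
      record Approximation (n : ℕ) : Set where
        field
          t y     : ℝ
          0≤t     : NonNeg (seq t)
          t<tc    : t < tc
          sum     : HasSum P t y
          t-close : Close (unit n) (seq t) (seq tc)
          y-close : Close (unit n) (seq y) (seq Ptc)

      approximation : ∀ n → Approximation n
      approximation n =
        let (ε , 0<ε , ε<tc) = Pos.0< 0<tc
            (γ , 0<γ , near-limit) = proj₂ limit (unit n) (unit-pos n)
            -- Three demands on the distance to `tc`: at most ε, so that t ≥ 0; at most 1/(n+1), for
            -- `t-close`; at most γ, for `y-close`.
            δ = ε ℚ.⊓ (unit n ℚ.⊓ γ)
            δ≤ε = ℚ.p⊓q≤p ε (unit n ℚ.⊓ γ)
            δ≤u⊓γ = ℚ.p⊓q≤q ε (unit n ℚ.⊓ γ)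
            δ≤u = ℚ.≤-trans δ≤u⊓γ (ℚ.p⊓q≤p (unit n) γ)
            δ≤γ = ℚ.≤-trans δ≤u⊓γ (ℚ.p⊓q≤q (unit n) γ)
            (t , y , tc-δ<t , t<tc , sum) = proj₁ limit δ (⊓-pos 0<ε (⊓-pos (unit-pos n) 0<γ))
            0<t-[tc-δ] = <⇒Pos {tc - fromℚ δ} {t} tc-δ<t
            0≤tc-δ = eventually-nonNeg (mapᵉ (λ {k} lt → within (ℚ.≤-<-trans δ≤ε lt)) ε<tc)
        in record
          { t = t ; y = y
          ; 0≤t = NonNeg-pointwise
              (λ k → solve 3 (λ t c d → (t :- (c :- d)) :+ (c :- d) := t) refl (seq t k) (seq tc k) δ)
              (+-nonNeg (Pos⇒NonNeg 0<t-[tc-δ]) 0≤tc-δ)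
          ; t<tc = t<tc ; sum = sum
          ; t-close = zipᵉ (λ {k} p q → near⁻¹ {seq t k} {seq tc k}
                (ℚ.<-trans (ℚ.<-trans (<+ (seq t k) (proj₁ (proj₂ t<tc))) q) (<+ (seq tc k) (unit-pos n)))
                (ℚ.<-≤-trans (shifted (ℚ.<-trans (<+ (seq tc k ℚ.- δ) (proj₁ (proj₂ tc-δ<t))) p))
                  (ℚ.+-monoʳ-≤ (seq t k) δ≤u)))
              (proj₂ (proj₂ tc-δ<t)) (proj₂ (proj₂ t<tc))
          ; y-close = strictly-close y Ptc (near-limit t y
              (Pos⇒< (tc - fromℚ γ) t (Pos-pointwise
                (λ k → solve 4 (λ t c d g → (t :- (c :- d)) :+ (g :- d) := t :- (c :- g)) refl
                  (seq t k) (seq tc k) δ γ)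
                (+-pos 0<t-[tc-δ] (nonNeg-pointwise λ _ → difference δ≤γ))))
              t<tc sum)
          }
        where
        eventually-nonNeg : ∀ {x : ℕ → ℚ} → Eventually (λ k → 0ℚ ℚ.< x k) → NonNeg x
        eventually-nonNeg ev = nonNeg λ ε 0<ε → mapᵉ (λ lt → Rational.+-pos lt 0<ε) ev

        within : ∀ {d c} → d ℚ.< c → 0ℚ ℚ.< c ℚ.- d
        within {d} {c} lt = subst (ℚ._< c ℚ.- d) (ℚ.+-inverseʳ d) (ℚ.+-monoˡ-< (ℚ.- d) lt)

        difference : ∀ {d c} → d ℚ.≤ c → 0ℚ ℚ.≤ c ℚ.- d
        difference {d} {c} le = subst (ℚ._≤ c ℚ.- d) (ℚ.+-inverseʳ d) (ℚ.+-monoˡ-≤ (ℚ.- d) le)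

        shifted : ∀ {c d t} → c ℚ.- d ℚ.< t → c ℚ.< t ℚ.+ d
        shifted {c} {d} {t} lt = subst (ℚ._< t ℚ.+ d)
          (solve 2 (λ c d → c :- d :+ d := c) refl c d) (ℚ.+-monoˡ-< d lt)

      bound-at-radius : fromℚ 1ℚ + √ (fromℚ (ι 2) * tc * Ptc) ≤ √ (fromℚ (ι 2) * Ptc)
      bound-at-radius = 1+√≤√ tc Ptc (nonNeg (proj₁ radius-P))
        (Pos⇒NonNeg (<⇒Pos {tc} {fromℚ 1ℚ} tc<1))
        -- P(t) ≥ 1 and, next, t² times the radicand ≥ 0 are known at the approximating points and
        -- survive in the limit.
        (⟶-nonNeg (λ n → Below.1≤Pt n) (⟶-- y⟶Ptc (⟶-const 1ℚ)))
        (⟶-nonNeg (λ n → Below.0≤t²disc n) (⟶-t²disc t⟶tc y⟶Ptc))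
        where
        module Approx n = Approximation (approximation n)
        module Below n = BelowRadius (Approx.t n) (Approx.y n) (Approx.0≤t n) (Approx.t<tc n) (Approx.sum n)

        t⟶tc : (λ n → seq (Approx.t n)) ⟶ seq tc
        t⟶tc = ⟶-unit (bounded tc) Approx.t-close

        y⟶Ptc : (λ n → seq (Approx.y n)) ⟶ seq Ptc
        y⟶Ptc = ⟶-unit (bounded Ptc) Approx.y-close

theorem3p1 : DequeEquation →
    (tc : ℝ) →
    RadiusOfConvergence P tc →
    RadiusOfConvergence D tc →
    tc < fromℚ 1ℚ →
    ((t Pt : ℝ) → fromℚ 0ℚ ≤ t → t < tc → HasSum P t Pt →
    fromℚ 1ℚ + √ (fromℚ (ι 2) * t * Pt) ≤ √ (fromℚ (ι 2) * Pt))
    ×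
    ((Ptc : ℝ) → LeftLimit (HasSum P) tc Ptc →
    fromℚ 1ℚ + √ (fromℚ (ι 2) * tc * Ptc) ≤ √ (fromℚ (ι 2) * Ptc))
theorem3p1 equation tc radius-P radius-D tc<1 =
    (λ t Pt 0≤t t<tc sum →
      let open BelowRadius equation tc radius-P radius-D tc<1 t Pt (nonNeg 0≤t) t<tc sum
      in 1+√≤√ t Pt (nonNeg 0≤t) t≤1 1≤Pt 0≤t²disc)
  , λ Ptc limit →
      let open AtRadius equation tc radius-P radius-D tc<1 Ptc limit
          lhs = fromℚ 1ℚ + √ (fromℚ (ι 2) * tc * Ptc)
          rhs = √ (fromℚ (ι 2) * Ptc)
      -- Positivity of `tc` is known only up to double negation, which is enough once the goal has
      -- become the refutation of `rhs < lhs`.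
      in ≮⇒≥ {lhs} {rhs} λ rhs<lhs → tc≰0 (≯⇒NonNeg tc (fromℚ 0ℚ) λ 0<tc-0 →
           ≤⇒≯ lhs rhs (bound-at-radius (Pos-pointwise (λ k → ℚ.+-identityʳ (seq tc k)) 0<tc-0)) rhs<lhs)
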